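{- Let $m$ be an odd prime, let $\alpha$ and $\beta$ be integers with $\alpha \geq 1$ and $\beta \geq 2$, and let $k$ be an integer with $1 \leq k \leq m-1$. Then the group \begin{align*} \langle \sigma_1, \sigma_2 \mid\ & \sigma_1^{2m^{\beta}} = \sigma_2^{m^{\beta}} = (\sigma_1 \sigma_2)^2 = 1;\ \sigma_2^{ -1} \sigma_1 = \sigma_1^{3+k(m+1)m^{\beta-1}} \sigma_2^{1+km^{\beta-1}};\\ & \sigma_2 \sigma_1^{ -1} = \sigma_1^{ -3+k(m+1)m^{\beta-1}} \sigma_2^{ -1+km^{\beta-1}};\ \sigma_1^{2m} \sigma_2 = \sigma_2 \sigma_1^{2m} \rangle \end{align*} is the automorphism group of a tight chiral polyhedron of type $\{2 m^{\beta}, m^{\beta}\}$. If $\beta > \alpha$, then the group \begin{align*} \langle \sigma_1, \sigma_2 \mid\ & \sigma_1^{2m^{\alpha}} = \sigma_2^{m^{\beta}} = (\sigma_1 \sigma_2)^2 = 1;\ \sigma_2^{ -1} \sigma_1 = \sigma_1^3 \sigma_2^{1+km^{\beta-1}};\\ & \sigma_2 \sigma_1^{ -1} = \sigma_1^{ -3} \sigma_2^{ -1+km^{\beta-1}};\ \sigma_1^{2m}\sigma_2 = \sigma_2 \sigma_1^{2m} \rangle \end{align*} is the automorphism group of a tight chiral polyhedron of type $\{2 m^{\alpha}, m^{\beta}\}$.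
   Context: An (abstract) polyhedron is a partially ordered set whose elements have rank $0$, $1$, $2$ (vertices, edges, faces), incidence meaning comparability, such that every edge is incident to exactly two vertices and two faces, whenever a vertex is incident to a face exactly two edges are incident to both, the incidence graph is connected, and for each vertex or face the subgraph of the incidence graph induced on its neighbours is connected. A flag is a mutually incident (vertex, edge, face) triple; $\Phi^i$ is the flag differing from $\Phi$ exactly in its rank-$i$ element. Type $\{p,q\}$: faces are incident to $p$ edges and vertices to $q$ edges. The polyhedron is chiral if its flags split into two classes with $\Phi,\Phi^i$ always in different classes and the automorphism group transitive on each class but not on all flags; then, fixing a base flag $\Phi$, the automorphism group is generated by $\sigma_1:\Phi\mapsto(\Phi^1)^0$ and $\sigma_2:\Phi\mapsto(\Phi^2)^1$. A group $\langle\sigma_1,\sigma_2\rangle$ "is the automorphism group of" such a polyhedron if there is an isomorphism onto it sending the generators $\sigma_1,\sigma_2$ to these distinguished generators. A polyhedron of type $\{p,q\}$ is tight if it has exactly $2pq$ flags. -}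

module Defs where

open import Data.Nat using (ℕ; zero; suc; _+_; _*_; _∸_; _^_; _≤_; _<_)
open import Data.Nat.Divisibility using (_∣_)
open import Data.Nat.Primality using (Prime)
open import Data.Integer as ℤ using (ℤ; +_; -[1+_])
open import Data.Fin using (Fin)
import Data.Fin as Fin
open import Data.Bool using (Bool; true; false; T; if_then_else_; _∧_; not)
open import Data.List using (List; []; _∷_; _++_; replicate; reverse; map)
open import Data.List.Membership.Propositional using (_∈_)
open import Data.Product using (Σ; Σ-syntax; _×_; _,_)
open import Data.Sum using (_⊎_; inj₁; inj₂)
open import Data.Unit using (⊤)
open import Data.Empty using (⊥)
open import Relation.Nullary using (¬_)
open import Relation.Binary.PropositionalEquality
  using (_≡_; _≢_; refl; sym; trans; cong; subst)
open import Function using (_∘_)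

count : ∀ {n} → (Fin n → Bool) → ℕ
count {zero}  P = 0
count {suc n} P = (if P Fin.zero then 1 else 0) + count (P ∘ Fin.suc)

sumFin : ∀ {n} → (Fin n → ℕ) → ℕ
sumFin {zero}  g = 0
sumFin {suc n} g = g Fin.zero + sumFin (g ∘ Fin.suc)

ExactlyTwo : ∀ {A : Set} → (A → Set) → Set
ExactlyTwo {A} P =
  Σ[ a ∈ A ] Σ[ b ∈ A ] (a ≢ b × P a × P b × (∀ c → P c → c ≡ a ⊎ c ≡ b))

-- Ranked incidence structure: a poset with elements of rank 0,1,2
-- (vertices Fin nV, edges Fin nE, faces Fin nF); incidence = comparability.

record Incidence : Set where
  field
    nV nE nF : ℕ
    IVE : Fin nV → Fin nE → Bool
    IEF : Fin nE → Fin nF → Bool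
    IVF : Fin nV → Fin nF → Bool

module _ (I : Incidence) where
  open Incidence I

  Elem : Set
  Elem = Fin nV ⊎ (Fin nE ⊎ Fin nF)

  Comparable : Elem → Elem → Set
  Comparable (inj₁ v)        (inj₁ _)        = ⊥
  Comparable (inj₁ v)        (inj₂ (inj₁ e)) = T (IVE v e)
  Comparable (inj₁ v)        (inj₂ (inj₂ f)) = T (IVF v f)
  Comparable (inj₂ (inj₁ e)) (inj₁ v)        = T (IVE v e)
  Comparable (inj₂ (inj₁ e)) (inj₂ (inj₁ _)) = ⊥
  Comparable (inj₂ (inj₁ e)) (inj₂ (inj₂ f)) = T (IEF e f)
  Comparable (inj₂ (inj₂ f)) (inj₁ v)        = T (IVF v f)
  Comparable (inj₂ (inj₂ f)) (inj₂ (inj₁ e)) = T (IEF e f)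
  Comparable (inj₂ (inj₂ f)) (inj₂ (inj₂ _)) = ⊥

  data Path (S : Elem → Set) : Elem → Elem → Set where
    here : ∀ {x} → Path S x x
    step : ∀ {x y z} → S y → Comparable x y → Path S y z → Path S x z

  ConnectedOn : (Elem → Set) → Set
  ConnectedOn S = ∀ x y → S x → S y → Path S x y

record Polyhedron : Set where
  field
    inc : Incidence
  open Incidence inc public
  field
    trans-VEF : ∀ v e f → T (IVE v e) → T (IEF e f) → T (IVF v f)
    edge-verts : ∀ e → ExactlyTwo (λ v → T (IVE v e))
    edge-faces : ∀ e → ExactlyTwo (λ f → T (IEF e f))
    diamond : ∀ v f → T (IVF v f) →
              ExactlyTwo (λ e → T (IVE v e) × T (IEF e f))
    connected : ConnectedOn inc (λ _ → ⊤)
    vertex-conn : ∀ v → ConnectedOn inc (Comparable inc (inj₁ v))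
    face-conn   : ∀ f → ConnectedOn inc (Comparable inc (inj₂ (inj₂ f)))

module _ (P : Polyhedron) where
  open Polyhedron P

  record Flag : Set where
    constructor flag
    field
      fv : Fin nV
      fe : Fin nE
      ff : Fin nF
      ve : T (IVE fv fe)
      ef : T (IEF fe ff)
  open Flag public

  FlagEq : Flag → Flag → Set
  FlagEq Φ Ψ = fv Φ ≡ fv Ψ × fe Φ ≡ fe Ψ × ff Φ ≡ ff Ψ

  Adjacent : Fin 3 → Flag → Flag → Set
  Adjacent Fin.zero Φ Ψ =
    fv Φ ≢ fv Ψ × fe Φ ≡ fe Ψ × ff Φ ≡ ff Ψ
  Adjacent (Fin.suc Fin.zero) Φ Ψ =
    fv Φ ≡ fv Ψ × fe Φ ≢ fe Ψ × ff Φ ≡ ff Ψ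
  Adjacent (Fin.suc (Fin.suc Fin.zero)) Φ Ψ =
    fv Φ ≡ fv Ψ × fe Φ ≡ fe Ψ × ff Φ ≢ ff Ψ

  flagCount : ℕ
  flagCount = sumFin (λ v → sumFin (λ e → count (λ f → IVE v e ∧ IEF e f)))

  HasType : ℕ → ℕ → Set
  HasType p q = (∀ f → count (λ e → IEF e f) ≡ p)
              × (∀ v → count (λ e → IVE v e) ≡ q)

  record Aut : Set where
    field
      aV : Fin nV → Fin nV
      bV : Fin nV → Fin nV
      aE : Fin nE → Fin nE
      bE : Fin nE → Fin nE
      aF : Fin nF → Fin nF
      bF : Fin nF → Fin nF
      baV : ∀ x → bV (aV x) ≡ x
      abV : ∀ x → aV (bV x) ≡ x
      baE : ∀ x → bE (aE x) ≡ x
      abE : ∀ x → aE (bE x) ≡ x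
      baF : ∀ x → bF (aF x) ≡ x
      abF : ∀ x → aF (bF x) ≡ x
      presVE : ∀ v e → IVE (aV v) (aE e) ≡ IVE v e
      presEF : ∀ e f → IEF (aE e) (aF f) ≡ IEF e f
      presVF : ∀ v f → IVF (aV v) (aF f) ≡ IVF v f
  open Aut public

  AutEq : Aut → Aut → Set
  AutEq a b = (∀ x → aV a x ≡ aV b x) × (∀ x → aE a x ≡ aE b x)
            × (∀ x → aF a x ≡ aF b x)

  idAut : Aut
  idAut = record
    { aV = λ x → x ; bV = λ x → x ; aE = λ x → x ; bE = λ x → x
    ; aF = λ x → x ; bF = λ x → x
    ; baV = λ _ → refl ; abV = λ _ → refl ; baE = λ _ → refl
    ; abE = λ _ → refl ; baF = λ _ → refl ; abF = λ _ → refl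
    ; presVE = λ _ _ → refl ; presEF = λ _ _ → refl ; presVF = λ _ _ → refl }

  _∘A_ : Aut → Aut → Aut
  a ∘A b = record
    { aV = aV a ∘ aV b ; bV = bV b ∘ bV a
    ; aE = aE a ∘ aE b ; bE = bE b ∘ bE a
    ; aF = aF a ∘ aF b ; bF = bF b ∘ bF a
    ; baV = λ x → trans (cong (bV b) (baV a (aV b x))) (baV b x)
    ; abV = λ x → trans (cong (aV a) (abV b (bV a x))) (abV a x)
    ; baE = λ x → trans (cong (bE b) (baE a (aE b x))) (baE b x)
    ; abE = λ x → trans (cong (aE a) (abE b (bE a x))) (abE a x)
    ; baF = λ x → trans (cong (bF b) (baF a (aF b x))) (baF b x)
    ; abF = λ x → trans (cong (aF a) (abF b (bF a x))) (abF a x)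
    ; presVE = λ v e → trans (presVE a (aV b v) (aE b e)) (presVE b v e)
    ; presEF = λ e f → trans (presEF a (aE b e) (aF b f)) (presEF b e f)
    ; presVF = λ v f → trans (presVF a (aV b v) (aF b f)) (presVF b v f) }

  invAut : Aut → Aut
  invAut a = record
    { aV = bV a ; bV = aV a ; aE = bE a ; bE = aE a ; aF = bF a ; bF = aF a
    ; baV = abV a ; abV = baV a ; baE = abE a ; abE = baE a
    ; baF = abF a ; abF = baF a
    ; presVE = λ v e → trans (sym (presVE a (bV a v) (bE a e)))
        (subst (λ z → IVE z (aE a (bE a e)) ≡ IVE v e) (sym (abV a v))
          (cong (IVE v) (abE a e)))
    ; presEF = λ e f → trans (sym (presEF a (bE a e) (bF a f)))
        (subst (λ z → IEF z (aF a (bF a f)) ≡ IEF e f) (sym (abE a e))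
          (cong (IEF e) (abF a f)))
    ; presVF = λ v f → trans (sym (presVF a (bV a v) (bF a f)))
        (subst (λ z → IVF z (aF a (bF a f)) ≡ IVF v f) (sym (abV a v))
          (cong (IVF v) (abF a f))) }

  act : Aut → Flag → Flag
  act a Φ = record
    { fv = aV a (fv Φ) ; fe = aE a (fe Φ) ; ff = aF a (ff Φ)
    ; ve = subst T (sym (presVE a (fv Φ) (fe Φ))) (ve Φ)
    ; ef = subst T (sym (presEF a (fe Φ) (ff Φ))) (ef Φ) }

  Chiral : Set
  Chiral =
    Σ[ cls ∈ (Flag → Bool) ]
      (∀ i Φ Ψ → Adjacent i Φ Ψ → cls Φ ≢ cls Ψ)
    × (∀ Φ Ψ → cls Φ ≡ cls Ψ → Σ[ a ∈ Aut ] FlagEq (act a Φ) Ψ)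
    × ¬ (∀ Φ Ψ → Σ[ a ∈ Aut ] FlagEq (act a Φ) Ψ)

  IsSigma1 : Flag → Aut → Set
  IsSigma1 Φ a = Σ[ Φ₁ ∈ Flag ] Σ[ Φ₁₀ ∈ Flag ]
    (Adjacent (Fin.suc Fin.zero) Φ Φ₁ × Adjacent Fin.zero Φ₁ Φ₁₀
     × FlagEq (act a Φ) Φ₁₀)

  IsSigma2 : Flag → Aut → Set
  IsSigma2 Φ a = Σ[ Φ₂ ∈ Flag ] Σ[ Φ₂₁ ∈ Flag ]
    (Adjacent (Fin.suc (Fin.suc Fin.zero)) Φ Φ₂
     × Adjacent (Fin.suc Fin.zero) Φ₂ Φ₂₁
     × FlagEq (act a Φ) Φ₂₁)

data Gen : Set where
  σ₁ σ₂ : Gen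

-- a letter is a generator with a sign (true = g, false = g⁻¹)
Letter : Set
Letter = Gen × Bool

Word : Set
Word = List Letter

invL : Letter → Letter
invL (g , s) = (g , not s)

pow : Gen → ℤ → Word
pow g (+ n)     = replicate n (g , true)
pow g -[1+ n ]  = replicate (suc n) (g , false)

gen : Gen → Word
gen g = (g , true) ∷ []

genInv : Gen → Word
genInv g = (g , false) ∷ []

Relations : Set
Relations = List (Word × Word)

data _≈⟨_⟩_ : Word → Relations → Word → Set where
  ≈-refl  : ∀ {R u} → u ≈⟨ R ⟩ u
  ≈-sym   : ∀ {R u v} → u ≈⟨ R ⟩ v → v ≈⟨ R ⟩ u
  ≈-trans : ∀ {R u v w} → u ≈⟨ R ⟩ v → v ≈⟨ R ⟩ w → u ≈⟨ R ⟩ w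
  ≈-free  : ∀ {R} u x v → (u ++ x ∷ invL x ∷ v) ≈⟨ R ⟩ (u ++ v)
  ≈-rel   : ∀ {R} u v l r → (l , r) ∈ R →
            (u ++ l ++ v) ≈⟨ R ⟩ (u ++ r ++ v)

module _ (P : Polyhedron) (s1 s2 : Aut P) where
  evalGen : Gen → Aut P
  evalGen σ₁ = s1
  evalGen σ₂ = s2

  evalL : Letter → Aut P
  evalL (g , true)  = evalGen g
  evalL (g , false) = invAut P (evalGen g)

  eval : Word → Aut P
  eval []      = idAut P
  eval (x ∷ w) = _∘A_ P (evalL x) (eval w)

-- The presented group ⟨σ₁,σ₂ ∣ R⟩ is the automorphism group of a tight
-- chiral polyhedron of type {p,q}, via an isomorphism sending σ₁,σ₂ to
-- the distinguished generators with respect to some base flag.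
IsAutGroupOfTightChiral : Relations → ℕ → ℕ → Set
IsAutGroupOfTightChiral R p q =
  Σ[ P ∈ Polyhedron ]
    HasType P p q
  × flagCount P ≡ 2 * p * q
  × Chiral P
  × Σ[ Φ ∈ Flag P ] Σ[ s1 ∈ Aut P ] Σ[ s2 ∈ Aut P ]
      ( IsSigma1 P Φ s1 × IsSigma2 P Φ s2
      × (∀ u v → (u ≈⟨ R ⟩ v → AutEq P (eval P s1 s2 u) (eval P s1 s2 v))
                × (AutEq P (eval P s1 s2 u) (eval P s1 s2 v) → u ≈⟨ R ⟩ v))
      × (∀ a → Σ[ w ∈ Word ] AutEq P a (eval P s1 s2 w)))

rels₁ : ℕ → ℕ → ℕ → Relations
rels₁ m β k =
    (pow σ₁ (+ (2 * m ^ β)) , [])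
  ∷ (pow σ₂ (+ (m ^ β)) , [])
  ∷ (gen σ₁ ++ gen σ₂ ++ gen σ₁ ++ gen σ₂ , [])
  ∷ (genInv σ₂ ++ gen σ₁ ,
       pow σ₁ (+ 3 ℤ.+ + (k * (m + 1) * m ^ (β ∸ 1)))
         ++ pow σ₂ (+ 1 ℤ.+ + (k * m ^ (β ∸ 1))))
  ∷ (gen σ₂ ++ genInv σ₁ ,
       pow σ₁ (ℤ.- (+ 3) ℤ.+ + (k * (m + 1) * m ^ (β ∸ 1)))
         ++ pow σ₂ (ℤ.- (+ 1) ℤ.+ + (k * m ^ (β ∸ 1))))
  ∷ (pow σ₁ (+ (2 * m)) ++ gen σ₂ , gen σ₂ ++ pow σ₁ (+ (2 * m)))
  ∷ []

rels₂ : ℕ → ℕ → ℕ → ℕ → Relations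
rels₂ m α β k =
    (pow σ₁ (+ (2 * m ^ α)) , [])
  ∷ (pow σ₂ (+ (m ^ β)) , [])
  ∷ (gen σ₁ ++ gen σ₂ ++ gen σ₁ ++ gen σ₂ , [])
  ∷ (genInv σ₂ ++ gen σ₁ ,
       pow σ₁ (+ 3) ++ pow σ₂ (+ 1 ℤ.+ + (k * m ^ (β ∸ 1))))
  ∷ (gen σ₂ ++ genInv σ₁ ,
       pow σ₁ (ℤ.- (+ 3)) ++ pow σ₂ (ℤ.- (+ 1) ℤ.+ + (k * m ^ (β ∸ 1))))
  ∷ (pow σ₁ (+ (2 * m)) ++ gen σ₂ , gen σ₂ ++ pow σ₁ (+ (2 * m)))
  ∷ []

{-# OPTIONS --safe #-}
module Submission where

-- Put A = m^α and B = m^β with α ≤ β, and let u represent k m^(β−1) / 4 modulo B.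
-- Both families are instances of one: for α < β the extra exponent k(m+1)m^(β−1)
-- of σ₁ vanishes modulo 2A.  In the group, τ = σ₁² and σ₂ generate a subgroup H of
-- index 2, nilpotent of class 2, with commutator τ^(2u) σ₂^(4u).  The stabiliser
-- ⟨σ₂σ₁⟩ of the base edge meets H trivially, so the edges correspond to the elements
-- of H, that is, to pairs (a , f) in ℤ/A × ℤ/B; the vertices are two copies of ℤ/A
-- and the faces are ℤ/B.  In these coordinates incidence and the two rotations are
-- polynomial, and every verification is a polynomial identity modulo u².
--
-- An automorphism that fixes the base vertex and the base face but moves the base
-- edge would send each face f to −f, while following it around the base face shows
-- that it sends 1 − 4u to −1 − 4u; then 8u ≡ 0 modulo B, which is false.  Hence an
-- automorphism is determined by the images of the base vertex and face.  This gives
-- chirality, and it reduces the relations to their effect on that vertex and face.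
-- Conversely, the relations bring every word to the form σ₂^j σ₁^i, and the images of
-- the base face and vertex determine j modulo B and i modulo 2A.

open import Defs
open import Data.Bool using (Bool; true; false; T; _∧_; _∨_; if_then_else_)
import Data.Bool.Properties as Boolₚ
open import Data.Empty using (⊥; ⊥-elim)
open import Data.Fin as Fin using (Fin; zero; suc; toℕ; fromℕ<; _↑ˡ_; _↑ʳ_; splitAt; combine; remQuot)
import Data.Fin.Properties as Finₚ
open import Data.Integer as ℤ using (ℤ; +_; -[1+_])
open import Data.Integer.DivMod using (_%ℕ_; _/ℕ_; n%ℕd<d; a≡a%ℕn+[a/ℕn]*n)
open import Data.Integer.Divisibility.Signed as ℤ∣ using () renaming (_∣_ to _∣ℤ_)
import Data.Integer.Properties as ℤₚ
open import Data.Integer.Tactic.RingSolver using (solve-∀)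
open import Data.List using ([]; _∷_; _++_; foldr; replicate)
open import Data.List.Membership.Propositional using (_∈_)
import Data.List.Properties as Listₚ
open import Data.List.Relation.Unary.Any using (here; there)
open import Data.Nat as ℕ using (ℕ; zero; suc; NonZero)
import Data.Nat.DivMod as ℕ
import Data.Nat.Divisibility as ℕ
import Data.Nat.Properties as ℕₚ
open import Data.Nat.Tactic.RingSolver using () renaming (solve-∀ to solveℕ-∀)
open import Data.Product using (Σ-syntax; _×_; _,_; proj₁; proj₂)
open import Data.Sum using (_⊎_; inj₁; inj₂; [_,_]′)
open import Data.Unit using (tt)
open import Function using (_∘_)
open import Function.Bundles using (Equivalence)
open import Relation.Binary.PropositionalEquality using (_≡_; _≢_; refl; sym; trans; cong; cong₂; subst; subst₂)
open import Relation.Nullary using (¬_; yes; no)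
open import Relation.Nullary.Decidable using (toWitness; fromWitness; ⌊_⌋)

-- Residue classes

-- A presentation bounds its group only from above; the danger is collapse. The normal form gives
-- the upper bound, and a concrete polyhedron on which the relations hold gives the lower one. Its
-- formulas are read off from H: `edge a f` is the image of `e₀` under the element τ^a σ₂^g, with g
-- = (1 + 4ua)f, that takes `v₀` to `V₀ a` and `f₀` to `face f`. On faces τ multiplies by 1 - 4u and
-- σ₂ adds 1; on the second copy of ℤ/A, τ adds 1 and σ₂ is x ↦ (1 - 2u)x - 1. Applying τ^a σ₂^g to
-- the remaining end `V₁ (- + 1)` and the remaining side `face (+ 1)` of `e₀` yields `far a f` and
-- `next a f`. Powers such as (1 - 4u)^n become 1 - 4un because u² vanishes. Iterating the affine
-- map produces triangular numbers g(g - 1)/2; measuring everything by a quarter of k m^(β-1) keeps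
-- all coefficients integral.

module Congruence where
  open import Data.Integer using (_+_; _-_; _*_; -_; ∣_∣)

  infix 4 _≈_[_]

  record _≈_[_] (a b : ℤ) (n : ℕ) : Set where
    constructor mod
    field divisible : + n ∣ℤ a - b
  open _≈_[_] public

  -- With the cofactor `t` supplied, a congruence is left as one polynomial identity for the ring
  -- solver. In the model `x` is u², u·A or u·M.
  by-multiple : ∀ {n a b x} t → + n ∣ℤ x → a - b ≡ t * x → a ≈ b [ n ]
  by-multiple {n} t n∣x eq = mod (subst (+ n ∣ℤ_) (sym eq) (ℤ∣.∣n⇒∣m*n t n∣x))

  ≈-reflexive : ∀ {n a b} → a ≡ b → a ≈ b [ n ]
  ≈-reflexive {a = a} refl = mod (ℤ∣.divides (+ 0) (ℤₚ.+-inverseʳ a))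

  ≈-rfl : ∀ {n a} → a ≈ a [ n ]
  ≈-rfl = ≈-reflexive refl

  ≈-symm : ∀ {n a b} → a ≈ b [ n ] → b ≈ a [ n ]
  ≈-symm {n} {a} {b} (mod p) = mod (subst (+ n ∣ℤ_) (lem a b) (ℤ∣.∣m⇒∣-m p))
    where
    lem : ∀ a b → - (a - b) ≡ b - a
    lem = solve-∀

  ≈-tran : ∀ {n a b c} → a ≈ b [ n ] → b ≈ c [ n ] → a ≈ c [ n ]
  ≈-tran {n} {a} {b} {c} (mod p) (mod q) = mod (subst (+ n ∣ℤ_) (lem a b c) (ℤ∣.∣m∣n⇒∣m+n p q))
    where
    lem : ∀ a b c → (a - b) + (b - c) ≡ a - c
    lem = solve-∀

  +-≈ : ∀ {n a b c d} → a ≈ b [ n ] → c ≈ d [ n ] → a + c ≈ b + d [ n ]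
  +-≈ {n} {a} {b} {c} {d} (mod p) (mod q) = mod (subst (+ n ∣ℤ_) (lem a b c d) (ℤ∣.∣m∣n⇒∣m+n p q))
    where
    lem : ∀ a b c d → (a - b) + (c - d) ≡ a + c - (b + d)
    lem = solve-∀

  neg-≈ : ∀ {n a b} → a ≈ b [ n ] → - a ≈ - b [ n ]
  neg-≈ {n} {a} {b} (mod p) = mod (subst (+ n ∣ℤ_) (lem a b) (ℤ∣.∣m⇒∣-m p))
    where
    lem : ∀ a b → - (a - b) ≡ - a - (- b)
    lem = solve-∀

  +-≈ʳ : ∀ {n a b} c → a ≈ b [ n ] → a + c ≈ b + c [ n ]
  +-≈ʳ c p = +-≈ p (≈-rfl {a = c})

  ∸-≈ : ∀ {n a b c d} → a ≈ b [ n ] → c ≈ d [ n ] → a - c ≈ b - d [ n ]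
  ∸-≈ p q = +-≈ p (neg-≈ q)

  *-≈ : ∀ {n a b c d} → a ≈ b [ n ] → c ≈ d [ n ] → a * c ≈ b * d [ n ]
  *-≈ {n} {a} {b} {c} {d} (mod p) (mod q) =
    mod (subst (+ n ∣ℤ_) (lem a b c d) (ℤ∣.∣m∣n⇒∣m+n (ℤ∣.∣n⇒∣m*n c p) (ℤ∣.∣n⇒∣m*n b q)))
    where
    lem : ∀ a b c d → c * (a - b) + b * (c - d) ≡ a * c - b * d
    lem = solve-∀

  *-≈ˡ : ∀ {n a b} c → a ≈ b [ n ] → c * a ≈ c * b [ n ]
  *-≈ˡ c p = *-≈ (≈-rfl {a = c}) p

  ≈-weaken : ∀ {k n a b} → + k ∣ℤ + n → a ≈ b [ n ] → a ≈ b [ k ]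
  ≈-weaken k∣n (mod p) = mod (ℤ∣.∣-trans k∣n p)

  private
    <-≈⇒≡ : ∀ n i j → i ℕ.< n → j ℕ.≤ i → + i ≈ + j [ n ] → i ≡ j
    <-≈⇒≡ n i j i<n j≤i p = ℕₚ.≤-antisym (ℕₚ.m∸n≡0⇒m≤n i∸j≡0) j≤i
      where
      n∣ : n ℕ.∣ i ℕ.∸ j
      n∣ = subst (n ℕ.∣_) (cong ∣_∣ (trans (ℤₚ.m-n≡m⊖n i j) (ℤₚ.⊖-≥ j≤i))) (ℤ∣.∣⇒∣ᵤ (divisible p))
      i∸j≡0 : i ℕ.∸ j ≡ 0
      i∸j≡0 with i ℕ.∸ j in eq
      ... | zero  = refl
      ... | suc d = ⊥-elim (ℕₚ.<⇒≱ i<n (ℕₚ.≤-trans (ℕ.∣⇒≤ (subst (n ℕ.∣_) eq n∣))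
                      (subst (ℕ._≤ i) eq (ℕₚ.m∸n≤m i j))))

    <-≈-unique : ∀ n i j → i ℕ.< n → j ℕ.< n → + i ≈ + j [ n ] → i ≡ j
    <-≈-unique n i j i<n j<n p with ℕₚ.≤-total i j
    ... | inj₁ i≤j = sym (<-≈⇒≡ n j i j<n i≤j (≈-symm p))
    ... | inj₂ j≤i = <-≈⇒≡ n i j i<n j≤i p

  module _ {n : ℕ} {{_ : NonZero n}} where

    rep : Fin n → ℤ
    rep x = + toℕ x

    opaque
      residue : ℤ → Fin n
      residue a = fromℕ< (n%ℕd<d a n)

      rep-residue : ∀ a → rep (residue a) ≈ a [ n ]
      rep-residue a = ≈-symm (mod (ℤ∣.divides (a /ℕ n) (trans (cong₂ _-_ (a≡a%ℕn+[a/ℕn]*n a n)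
                                (cong +_ (Finₚ.toℕ-fromℕ< (n%ℕd<d a n)))) (lem (+ (a %ℕ n)) (a /ℕ n * + n)))))
        where
        lem : ∀ r s → r + s - r ≡ s
        lem = solve-∀

      residue-injective : ∀ {a b} → residue a ≡ residue b → a ≈ b [ n ]
      residue-injective {a} {b} eq =
        ≈-tran (≈-symm (rep-residue a)) (subst (λ x → rep x ≈ b [ n ]) (sym eq) (rep-residue b))

      residue-cong : ∀ {a b} → a ≈ b [ n ] → residue a ≡ residue b
      residue-cong {a} {b} p = Finₚ.fromℕ<-cong _ _
        (<-≈-unique n _ _ (n%ℕd<d a n) (n%ℕd<d b n)
          (≈-tran (subst (λ x → + x ≈ a [ n ]) (Finₚ.toℕ-fromℕ< _) (rep-residue a))
            (≈-tran p (≈-symm (subst (λ x → + x ≈ b [ n ]) (Finₚ.toℕ-fromℕ< _) (rep-residue b))))))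
        _ _

      residue-rep : ∀ x → residue (rep x) ≡ x
      residue-rep x = trans (Finₚ.fromℕ<-cong _ _ (ℕ.m<n⇒m%n≡m (Finₚ.toℕ<n x)) _ (Finₚ.toℕ<n x))
        (Finₚ.fromℕ<-toℕ x _)

      ≈⇒%≡ : ∀ {i j} → + i ≈ + j [ n ] → i ℕ.% n ≡ j ℕ.% n
      ≈⇒%≡ {i} {j} p = trans (sym (Finₚ.toℕ-fromℕ< (n%ℕd<d (+ i) n)))
        (trans (cong toℕ (residue-cong p)) (Finₚ.toℕ-fromℕ< (n%ℕd<d (+ j) n)))

open Congruence

-- Counting

enumerate : ∀ {n} (P : Fin n → Bool) → Fin (count P) → Fin n
enumerate {ℕ.suc n} P i with P zero
enumerate {ℕ.suc n} P zero    | true  = zero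
enumerate {ℕ.suc n} P (suc i) | true  = suc (enumerate (P ∘ suc) i)
enumerate {ℕ.suc n} P i       | false = suc (enumerate (P ∘ suc) i)

enumerate-sound : ∀ {n} (P : Fin n → Bool) i → T (P (enumerate P i))
enumerate-sound {ℕ.suc n} P i with P zero in eq
enumerate-sound {ℕ.suc n} P zero    | true  = subst T (sym eq) tt
enumerate-sound {ℕ.suc n} P (suc i) | true  = enumerate-sound (P ∘ suc) i
enumerate-sound {ℕ.suc n} P i       | false = enumerate-sound (P ∘ suc) i

enumerate-injective : ∀ {n} (P : Fin n → Bool) i j → enumerate P i ≡ enumerate P j → i ≡ j
enumerate-injective {ℕ.suc n} P i j eq with P zero
enumerate-injective {ℕ.suc n} P zero    zero    eq | true = refl
enumerate-injective {ℕ.suc n} P (suc i) (suc j) eq | true =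
  cong suc (enumerate-injective (P ∘ suc) i j (Finₚ.suc-injective eq))
enumerate-injective {ℕ.suc n} P i j eq | false =
  enumerate-injective (P ∘ suc) i j (Finₚ.suc-injective eq)

position : ∀ {n} (P : Fin n → Bool) x → T (P x) → Fin (count P)
position P zero px with P zero
... | true = zero
position P (suc x) px with P zero
... | true  = suc (position (P ∘ suc) x px)
... | false = position (P ∘ suc) x px

position-injective : ∀ {n} (P : Fin n → Bool) x y px py →
                     position P x px ≡ position P y py → x ≡ y
position-injective P zero zero px py eq = refl
position-injective P zero (suc y) px py eq with P zero
position-injective P zero (suc y) px py () | true
position-injective P (suc x) zero px py eq with P zero
position-injective P (suc x) zero px py () | true
position-injective P (suc x) (suc y) px py eq with P zero
... | true  = cong suc (position-injective (P ∘ suc) x y px py (Finₚ.suc-injective eq))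
... | false = cong suc (position-injective (P ∘ suc) x y px py eq)

-- `enumerate` and `position` pass between `Fin (count P)` and the elements satisfying `P`; the two
-- resulting injections bound each number by the other.
count-by-bijection : ∀ {n p} (P : Fin n → Bool) (g : Fin p → Fin n) →
                     (∀ i → T (P (g i))) → (∀ {i j} → g i ≡ g j → i ≡ j) →
                     (∀ x → T (P x) → Σ[ i ∈ Fin p ] g i ≡ x) → count P ≡ p
count-by-bijection P g Pg g-inj onto = ℕₚ.≤-antisym
  (Finₚ.injective⇒≤ {f = λ j → proj₁ (pre j)} λ {i} {j} eq → enumerate-injective P i j
    (trans (sym (proj₂ (pre i))) (trans (cong g eq) (proj₂ (pre j)))))
  (Finₚ.injective⇒≤ {f = λ i → position P (g i) (Pg i)} λ eq → g-inj (position-injective P _ _ _ _ eq))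
  where
  pre : ∀ j → Σ[ i ∈ _ ] g i ≡ enumerate P j
  pre j = onto (enumerate P j) (enumerate-sound P j)

count-exactly-two : ∀ {n} (P : Fin n → Bool) → ExactlyTwo (T ∘ P) → count P ≡ 2
count-exactly-two P (a , b , a≢b , Pa , Pb , only) = count-by-bijection P
  (λ { zero → a ; (suc zero) → b })
  (λ { zero → Pa ; (suc zero) → Pb })
  (λ { {zero} {zero} _ → refl ; {zero} {suc zero} e → ⊥-elim (a≢b e)
     ; {suc zero} {zero} e → ⊥-elim (a≢b (sym e)) ; {suc zero} {suc zero} _ → refl })
  (λ x px → [ (λ e → zero , sym e) , (λ e → suc zero , sym e) ]′ (only x px))

sumFin-cong : ∀ {n} {g h : Fin n → ℕ} → (∀ i → g i ≡ h i) → sumFin g ≡ sumFin h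
sumFin-cong {ℕ.zero}  eq = refl
sumFin-cong {ℕ.suc n} eq = cong₂ ℕ._+_ (eq zero) (sumFin-cong (eq ∘ suc))

sumFin-const : ∀ n k → sumFin {n} (λ _ → k) ≡ n ℕ.* k
sumFin-const ℕ.zero    k = refl
sumFin-const (ℕ.suc n) k = cong (k ℕ.+_) (sumFin-const n k)

sumFin-indicator : ∀ {n} (P : Fin n → Bool) k →
                   sumFin (λ i → if P i then k else 0) ≡ count P ℕ.* k
sumFin-indicator {ℕ.zero}  P k = refl
sumFin-indicator {ℕ.suc n} P k with P zero
... | true  = cong (k ℕ.+_) (sumFin-indicator (P ∘ suc) k)
... | false = sumFin-indicator (P ∘ suc) k

count-false : ∀ n → count {n} (λ _ → false) ≡ 0
count-false ℕ.zero    = refl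
count-false (ℕ.suc n) = count-false n

-- An incident vertex-edge pair lies in two flags, one for each face of the edge.
flagCount-by-valency : ∀ P q → (∀ v → count (Polyhedron.IVE P v) ≡ q) →
                       flagCount P ≡ Polyhedron.nV P ℕ.* (q ℕ.* 2)
flagCount-by-valency P q valency = trans (sumFin-cong at-vertex) (sumFin-const nV (q ℕ.* 2))
  where
  open Polyhedron P
  at-edge : ∀ v e → count (λ f → IVE v e ∧ IEF e f) ≡ (if IVE v e then 2 else 0)
  at-edge v e with IVE v e
  ... | true  = count-exactly-two (IEF e) (edge-faces e)
  ... | false = count-false nF
  at-vertex : ∀ v → sumFin (λ e → count (λ f → IVE v e ∧ IEF e f)) ≡ q ℕ.* 2
  at-vertex v = trans (sumFin-cong (at-edge v))
    (trans (sumFin-indicator (IVE v) 2) (cong (ℕ._* 2) (valency v)))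

-- Incidence structures and automorphisms

-- The form in which the axioms of a polyhedron are used: of two candidates, the one that differs
-- from `z` is determined. This makes the i-adjacent flag unique and forces its image under an
-- automorphism.
exactly-two-unique : ∀ {A : Set} {Q : A → Set} {x y z} → ExactlyTwo Q →
                     Q x → Q y → Q z → x ≢ z → y ≢ z → x ≡ y
exactly-two-unique (a , b , _ , _ , _ , only) qx qy qz x≢z y≢z
  with only _ qx | only _ qy | only _ qz
... | inj₁ refl | inj₁ refl | _         = refl
... | inj₂ refl | inj₂ refl | _         = refl
... | inj₁ refl | inj₂ refl | inj₁ refl = ⊥-elim (x≢z refl)
... | inj₁ refl | inj₂ refl | inj₂ refl = ⊥-elim (y≢z refl)
... | inj₂ refl | inj₁ refl | inj₁ refl = ⊥-elim (y≢z refl)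
... | inj₂ refl | inj₁ refl | inj₂ refl = ⊥-elim (x≢z refl)

module Paths (I : Incidence) where

  Comparable-sym : ∀ x y → Comparable I x y → Comparable I y x
  Comparable-sym (inj₁ _)        (inj₂ (inj₁ _)) c = c
  Comparable-sym (inj₁ _)        (inj₂ (inj₂ _)) c = c
  Comparable-sym (inj₂ (inj₁ _)) (inj₁ _)        c = c
  Comparable-sym (inj₂ (inj₁ _)) (inj₂ (inj₂ _)) c = c
  Comparable-sym (inj₂ (inj₂ _)) (inj₁ _)        c = c
  Comparable-sym (inj₂ (inj₂ _)) (inj₂ (inj₁ _)) c = c

  _◅◅_ : ∀ {S x y z} → Path I S x y → Path I S y z → Path I S x z
  here        ◅◅ q = q
  step sy c p ◅◅ q = step sy c (p ◅◅ q)

  reversePath : ∀ {S x y} → S x → Path I S x y → Path I S y x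
  reversePath sx here                  = here
  reversePath sx (step {x} {y} sy c p) = reversePath sy p ◅◅ step sx (Comparable-sym x y c) here

  connected-through : ∀ {S} h → (∀ x → S x → Path I S x h) → ConnectedOn I S
  connected-through h to x y sx sy = to x sx ◅◅ reversePath sy (to y sy)

  mapPath : ∀ {S S′ : Elem I → Set} (g : Elem I → Elem I) →
            (∀ x y → Comparable I x y → Comparable I (g x) (g y)) →
            (∀ x → S x → S′ (g x)) →
            ∀ {x y} → Path I S x y → Path I S′ (g x) (g y)
  mapPath g pres into here          = here
  mapPath g pres into (step sy c p) = step (into _ sy) (pres _ _ c) (mapPath g pres into p)

  -- The end points are pulled back along `h`, joined by a path in the original link, and that path
  -- is pushed forward along `g`.
  connected-transport : (g h : Elem I → Elem I) → (∀ x → g (h x) ≡ x) → (∀ x → h (g x) ≡ x) →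
    (∀ x y → Comparable I x y → Comparable I (g x) (g y)) →
    (∀ x y → Comparable I x y → Comparable I (h x) (h y)) →
    ∀ x → ConnectedOn I (Comparable I x) → ConnectedOn I (Comparable I (g x))
  connected-transport g h gh hg g-pres h-pres x conn y z cy cz =
    subst₂ (Path I (Comparable I (g x))) (gh y) (gh z)
      (mapPath g g-pres (λ w → g-pres x w)
        (conn (h y) (h z) (pull y cy) (pull z cz)))
    where
    pull : ∀ y → Comparable I (g x) y → Comparable I x (h y)
    pull y c = subst (λ w → Comparable I w (h y)) (hg x) (h-pres _ _ c)

-- The same data as `Aut`, but on an `Incidence`: `Aut` presupposes a `Polyhedron`, whose connected
-- links are themselves obtained by moving one link around with symmetries.
record Symmetry (I : Incidence) : Set where
  open Incidence I
  field
    toV fromV : Fin nV → Fin nV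
    toE fromE : Fin nE → Fin nE
    toF fromF : Fin nF → Fin nF
    from-toV : ∀ x → fromV (toV x) ≡ x
    to-fromV : ∀ x → toV (fromV x) ≡ x
    from-toE : ∀ x → fromE (toE x) ≡ x
    to-fromE : ∀ x → toE (fromE x) ≡ x
    from-toF : ∀ x → fromF (toF x) ≡ x
    to-fromF : ∀ x → toF (fromF x) ≡ x
    preserveVE : ∀ v e → IVE (toV v) (toE e) ≡ IVE v e
    preserveEF : ∀ e f → IEF (toE e) (toF f) ≡ IEF e f
    preserveVF : ∀ v f → IVF (toV v) (toF f) ≡ IVF v f

module _ {I : Incidence} (s : Symmetry I) where
  open Incidence I
  open Symmetry s

  mapElem : Elem I → Elem I
  mapElem (inj₁ v)        = inj₁ (toV v)
  mapElem (inj₂ (inj₁ e)) = inj₂ (inj₁ (toE e))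
  mapElem (inj₂ (inj₂ f)) = inj₂ (inj₂ (toF f))

  mapElem-comparable : ∀ x y → Comparable I x y → Comparable I (mapElem x) (mapElem y)
  mapElem-comparable (inj₁ v)        (inj₂ (inj₁ e)) = subst T (sym (preserveVE v e))
  mapElem-comparable (inj₁ v)        (inj₂ (inj₂ f)) = subst T (sym (preserveVF v f))
  mapElem-comparable (inj₂ (inj₁ e)) (inj₁ v)        = subst T (sym (preserveVE v e))
  mapElem-comparable (inj₂ (inj₁ e)) (inj₂ (inj₂ f)) = subst T (sym (preserveEF e f))
  mapElem-comparable (inj₂ (inj₂ f)) (inj₁ v)        = subst T (sym (preserveVF v f))
  mapElem-comparable (inj₂ (inj₂ f)) (inj₂ (inj₁ e)) = subst T (sym (preserveEF e f))

  inverseSymmetry : Symmetry I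
  inverseSymmetry = record
    { toV = fromV ; fromV = toV ; toE = fromE ; fromE = toE ; toF = fromF ; fromF = toF
    ; from-toV = to-fromV ; to-fromV = from-toV ; from-toE = to-fromE ; to-fromE = from-toE
    ; from-toF = to-fromF ; to-fromF = from-toF
    ; preserveVE = λ v e → trans (sym (preserveVE _ _)) (cong₂ IVE (to-fromV v) (to-fromE e))
    ; preserveEF = λ e f → trans (sym (preserveEF _ _)) (cong₂ IEF (to-fromE e) (to-fromF f))
    ; preserveVF = λ v f → trans (sym (preserveVF _ _)) (cong₂ IVF (to-fromV v) (to-fromF f)) }

mapElem-inverse : ∀ {I} (s : Symmetry I) x → mapElem s (mapElem (inverseSymmetry s) x) ≡ x
mapElem-inverse s (inj₁ v)        = cong inj₁ (Symmetry.to-fromV s v)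
mapElem-inverse s (inj₂ (inj₁ e)) = cong (inj₂ ∘ inj₁) (Symmetry.to-fromE s e)
mapElem-inverse s (inj₂ (inj₂ f)) = cong (inj₂ ∘ inj₂) (Symmetry.to-fromF s f)

inverse-mapElem : ∀ {I} (s : Symmetry I) x → mapElem (inverseSymmetry s) (mapElem s x) ≡ x
inverse-mapElem s (inj₁ v)        = cong inj₁ (Symmetry.from-toV s v)
inverse-mapElem s (inj₂ (inj₁ e)) = cong (inj₂ ∘ inj₁) (Symmetry.from-toE s e)
inverse-mapElem s (inj₂ (inj₂ f)) = cong (inj₂ ∘ inj₂) (Symmetry.from-toF s f)

link-transport : ∀ {I} (s : Symmetry I) x →
                 ConnectedOn I (Comparable I x) → ConnectedOn I (Comparable I (mapElem s x))
link-transport {I} s = Paths.connected-transport I (mapElem s) (mapElem (inverseSymmetry s))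
  (mapElem-inverse s) (inverse-mapElem s)
  (mapElem-comparable s) (mapElem-comparable (inverseSymmetry s))

module Automorphisms (P : Polyhedron) where
  open Polyhedron P

  symmetryAut : Symmetry inc → Aut P
  symmetryAut s = record
    { aV = toV ; bV = fromV ; aE = toE ; bE = fromE ; aF = toF ; bF = fromF
    ; baV = from-toV ; abV = to-fromV ; baE = from-toE ; abE = to-fromE ; baF = from-toF ; abF = to-fromF
    ; presVE = preserveVE ; presEF = preserveEF ; presVF = preserveVF }
    where open Symmetry s

  aV-injective : ∀ (a : Aut P) {x y} → aV a x ≡ aV a y → x ≡ y
  aV-injective a {x} {y} eq = trans (sym (baV a x)) (trans (cong (bV a) eq) (baV a y))

  aE-injective : ∀ (a : Aut P) {x y} → aE a x ≡ aE a y → x ≡ y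
  aE-injective a {x} {y} eq = trans (sym (baE a x)) (trans (cong (bE a) eq) (baE a y))

  aF-injective : ∀ (a : Aut P) {x y} → aF a x ≡ aF a y → x ≡ y
  aF-injective a {x} {y} eq = trans (sym (baF a x)) (trans (cong (bF a) eq) (baF a y))

  module _ (a : Aut P) where
    imageVE : ∀ {v e} → T (IVE v e) → T (IVE (aV a v) (aE a e))
    imageVE = subst T (sym (presVE a _ _))

    imageEF : ∀ {e f} → T (IEF e f) → T (IEF (aE a e) (aF a f))
    imageEF = subst T (sym (presEF a _ _))

  module _ (a b : Aut P) where

    -- Agreement is stored for an edge together with all its ends and sides, because in this form it
    -- passes from edge to edge.
    record AgreeAt (e : Fin nE) : Set where
      constructor agree
      field
        on-edge     : aE a e ≡ aE b e
        on-vertices : ∀ v → T (IVE v e) → aV a v ≡ aV b v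
        on-faces    : ∀ f → T (IEF e f) → aF a f ≡ aF b f
    open AgreeAt public

    -- An edge has only two ends and two sides, so the images of the other end and of the other side
    -- are forced.
    agree-at-flag : ∀ {v e f} → T (IVE v e) → T (IEF e f) →
                    aV a v ≡ aV b v → aE a e ≡ aE b e → aF a f ≡ aF b f → AgreeAt e
    agree-at-flag {v} {e} {f} ve ef eqV eqE eqF = agree eqE vertices faces
      where
      vertices : ∀ w → T (IVE w e) → aV a w ≡ aV b w
      vertices w we with w Fin.≟ v
      ... | yes refl = eqV
      ... | no w≢v = exactly-two-unique (edge-verts (aE a e))
              (imageVE a we) (subst (T ∘ IVE _) (sym eqE) (imageVE b we)) (imageVE a ve)
              (w≢v ∘ aV-injective a) (λ eq → w≢v (aV-injective b (trans eq eqV)))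
      faces : ∀ g → T (IEF e g) → aF a g ≡ aF b g
      faces g eg with g Fin.≟ f
      ... | yes refl = eqF
      ... | no g≢f = exactly-two-unique (edge-faces (aE a e))
              (imageEF a eg) (subst (λ x → T (IEF x _)) (sym eqE) (imageEF b eg)) (imageEF a ef)
              (g≢f ∘ aF-injective a) (λ eq → g≢f (aF-injective b (trans eq eqF)))

    -- By the diamond condition only two edges lie at a given vertex and face, so the image of the
    -- first one forces that of the second.
    agree-step : ∀ {e e′ v f} → T (IVE v e) → T (IEF e f) → T (IVE v e′) → T (IEF e′ f) →
                 AgreeAt e → AgreeAt e′
    agree-step {e} {e′} {v} {f} ve ef ve′ ef′ ag with e′ Fin.≟ e
    ... | yes refl = ag
    ... | no e′≢e = agree-at-flag ve′ ef′ eqV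
          (exactly-two-unique (diamond (aV a v) (aF a f)
              (trans-VEF _ _ _ (imageVE a ve) (imageEF a ef)))
            (imageVE a ve′ , imageEF a ef′)
            (subst (λ x → T (IVE x _)) (sym eqV) (imageVE b ve′) ,
             subst (T ∘ IEF _) (sym eqF) (imageEF b ef′))
            (imageVE a ve , imageEF a ef)
            (e′≢e ∘ aE-injective a)
            (λ eq → e′≢e (aE-injective b (trans eq (on-edge ag)))))
          eqF
      where
      eqV = on-vertices ag v ve
      eqF = on-faces ag f ef

    agree-everywhere : (∀ v → Σ[ e ∈ Fin nE ] T (IVE v e)) → (∀ f → Σ[ e ∈ Fin nE ] T (IEF e f)) →
                       (∀ e → AgreeAt e) → AutEq P a b
    agree-everywhere edgeAtV edgeAtF all =
      (λ v → let e , ve = edgeAtV v in on-vertices (all e) v ve) ,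
      (λ e → on-edge (all e)) ,
      (λ f → let e , ef = edgeAtF f in on-faces (all e) f ef)

-- Words and presentations

ℤ-induction : (Q : ℤ → Set) → Q (+ 0) → (∀ n → Q n → Q (+ 1 ℤ.+ n)) →
              (∀ n → Q (+ 1 ℤ.+ n) → Q n) → ∀ n → Q n
ℤ-induction Q base up down (+ zero)      = base
ℤ-induction Q base up down (+ suc n)     = up (+ n) (ℤ-induction Q base up down (+ n))
ℤ-induction Q base up down -[1+ zero ]   = down -[1+ 0 ] base
ℤ-induction Q base up down -[1+ suc n ]  = down -[1+ suc n ] (ℤ-induction Q base up down -[1+ n ])

module Action {X : Set} (act : Letter → X → X) (inverse : ∀ l x → act l (act (invL l) x) ≡ x) where

  run : Word → X → X
  run w x = foldr act x w

  run-++ : ∀ u v x → run (u ++ v) x ≡ run u (run v x)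
  run-++ u v x = Listₚ.foldr-++ act x u v

  run-pow-suc : ∀ g n x → run (pow g (+ 1 ℤ.+ n)) x ≡ act (g , true) (run (pow g n) x)
  run-pow-suc g (+ n)           x = refl
  run-pow-suc g -[1+ zero ]     x = sym (inverse (g , true) x)
  run-pow-suc g -[1+ suc n ]    x = sym (inverse (g , true) (run (pow g -[1+ n ]) x))

  run-sound : ∀ R → (∀ l r → (l , r) ∈ R → ∀ x → run l x ≡ run r x) →
              ∀ {u v} → u ≈⟨ R ⟩ v → ∀ x → run u x ≡ run v x
  run-sound R sound ≈-refl        x = refl
  run-sound R sound (≈-sym p)     x = sym (run-sound R sound p x)
  run-sound R sound (≈-trans p q) x = trans (run-sound R sound p x) (run-sound R sound q x)
  run-sound R sound (≈-free u l v) x =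
    trans (run-++ u _ x) (trans (cong (run u) (inverse l (run v x))) (sym (run-++ u v x)))
  run-sound R sound (≈-rel u v l r lr∈R) x =
    trans (run-++ u _ x) (trans (cong (run u) (trans (run-++ l v x)
      (trans (sound l r lr∈R (run v x)) (sym (run-++ r v x))))) (sym (run-++ u _ x)))

  act-injective : ∀ g {x y} → act (g , true) x ≡ act (g , true) y → x ≡ y
  act-injective g {x} {y} eq =
    trans (sym (inverse (g , false) x)) (trans (cong (act (g , false)) eq) (inverse (g , false) y))

  -- A two-sided sequence on which `g` acts as a shift describes all powers of `g`, negative ones
  -- included, without a formula for the inverse letter: the downward step only needs injectivity.
  run-orbit : ∀ g (φ : ℤ → X) → (∀ n → act (g , true) (φ n) ≡ φ (+ 1 ℤ.+ n)) →
              ∀ n → run (pow g n) (φ (+ 0)) ≡ φ n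
  run-orbit g φ next = ℤ-induction _ refl
    (λ n eq → trans (run-pow-suc g n _) (trans (cong (act (g , true)) eq) (next n)))
    (λ n eq → act-injective g (trans (sym (run-pow-suc g n _)) (trans eq (sym (next n)))))

  -- Two interleaved sequences: σ₁ exchanges the copies `V₀` and `V₁` of ℤ/A, and on faces it is its
  -- square that has a linear orbit formula.
  module _ (g : Gen) (φ₀ φ₁ : ℤ → X) (next₀ : ∀ n → act (g , true) (φ₀ n) ≡ φ₁ n)
           (next₁ : ∀ n → act (g , true) (φ₁ n) ≡ φ₀ (+ 1 ℤ.+ n)) where

    run-orbit-even : ∀ n → run (pow g (+ 2 ℤ.* n)) (φ₀ (+ 0)) ≡ φ₀ n
    run-orbit-even = ℤ-induction _ refl
      (λ n eq → trans (two-steps n) (trans (cong (act (g , true) ∘ act (g , true)) eq)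
        (trans (cong (act (g , true)) (next₀ n)) (next₁ n))))
      (λ n eq → act-injective g (act-injective g (trans (sym (two-steps n))
        (trans eq (sym (trans (cong (act (g , true)) (next₀ n)) (next₁ n)))))))
      where
      lem : ∀ n → + 2 ℤ.* (+ 1 ℤ.+ n) ≡ + 1 ℤ.+ (+ 1 ℤ.+ + 2 ℤ.* n)
      lem = solve-∀
      two-steps : ∀ n → run (pow g (+ 2 ℤ.* (+ 1 ℤ.+ n))) (φ₀ (+ 0))
                        ≡ act (g , true) (act (g , true) (run (pow g (+ 2 ℤ.* n)) (φ₀ (+ 0))))
      two-steps n = trans (cong (λ k → run (pow g k) (φ₀ (+ 0))) (lem n))
        (trans (run-pow-suc g (+ 1 ℤ.+ + 2 ℤ.* n) (φ₀ (+ 0)))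
          (cong (act (g , true)) (run-pow-suc g (+ 2 ℤ.* n) (φ₀ (+ 0)))))

    run-orbit-odd : ∀ n → run (pow g (+ 1 ℤ.+ + 2 ℤ.* n)) (φ₀ (+ 0)) ≡ φ₁ n
    run-orbit-odd n = trans (run-pow-suc g (+ 2 ℤ.* n) (φ₀ (+ 0)))
      (trans (cong (act (g , true)) (run-orbit-even n)) (next₀ n))

-- Normal forms in the presented group

module Presentations where
  open import Data.Nat using (_+_; _*_)

  -- The common shape of both families: `E` and `C` are the extra exponents of σ₁ and σ₂. For
  -- `E = 0` the exponents 3 + 0 and -3 + 0 compute, so the second family is an instance by
  -- definition.
  presentation : (p q M E C : ℕ) → Relations
  presentation p q M E C =
      (pow σ₁ (+ p) , [])
    ∷ (pow σ₂ (+ q) , [])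
    ∷ (gen σ₁ ++ gen σ₂ ++ gen σ₁ ++ gen σ₂ , [])
    ∷ (genInv σ₂ ++ gen σ₁ , pow σ₁ (+ 3 ℤ.+ + E) ++ pow σ₂ (+ 1 ℤ.+ + C))
    ∷ (gen σ₂ ++ genInv σ₁ , pow σ₁ (ℤ.- (+ 3) ℤ.+ + E) ++ pow σ₂ (ℤ.- (+ 1) ℤ.+ + C))
    ∷ (pow σ₁ (+ (2 * M)) ++ gen σ₂ , gen σ₂ ++ pow σ₁ (+ (2 * M)))
    ∷ []

  ≈-cons : ∀ {R u v} l → u ≈⟨ R ⟩ v → (l ∷ u) ≈⟨ R ⟩ (l ∷ v)
  ≈-cons l ≈-refl               = ≈-refl
  ≈-cons l (≈-sym p)            = ≈-sym (≈-cons l p)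
  ≈-cons l (≈-trans p q)        = ≈-trans (≈-cons l p) (≈-cons l q)
  ≈-cons l (≈-free u x v)       = ≈-free (l ∷ u) x v
  ≈-cons l (≈-rel u v x y xy∈R) = ≈-rel (l ∷ u) v x y xy∈R

  -- The extra exponent of σ₁ is given the form 2·M·t, so that the commuting relation applies to its
  -- power.
  module NormalForm (p q M t C : ℕ) {{_ : NonZero p}} {{_ : NonZero q}} where

    R : Relations
    R = presentation p q M (2 * M * t) C

    infix 4 _≈_
    _≈_ : Word → Word → Set
    u ≈ v = u ≈⟨ R ⟩ v

    infixr 4 _⟫_
    _⟫_ : ∀ {u v w} → u ≈ v → v ≈ w → u ≈ w
    _⟫_ = ≈-trans

    a b a⁻ b⁻ : Letter
    a  = σ₁ , true
    b  = σ₂ , true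
    a⁻ = σ₁ , false
    b⁻ = σ₂ , false

    infixr 6 _^_·_
    _^_·_ : Letter → ℕ → Word → Word
    l ^ n · w = replicate n l ++ w

    ^-+ : ∀ l m n w → l ^ (m + n) · w ≡ l ^ m · l ^ n · w
    ^-+ l zero    n w = refl
    ^-+ l (suc m) n w = cong (l ∷_) (^-+ l m n w)

    ^-cong : ∀ l n {u v} → u ≈ v → l ^ n · u ≈ l ^ n · v
    ^-cong l zero    e = e
    ^-cong l (suc n) e = ≈-cons l (^-cong l n e)

    ≈-≡ : ∀ {u v} → u ≡ v → u ≈ v
    ≈-≡ refl = ≈-refl

    cancel : ∀ l w → l ∷ invL l ∷ w ≈ w
    cancel l w = ≈-free [] l w

    rel : ∀ l r → (l , r) ∈ R → ∀ w → l ++ w ≈ r ++ w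
    rel l r lr∈R w = ≈-rel [] w l r lr∈R

    a-order : ∀ w → a ^ p · w ≈ w
    a-order = rel _ _ (here refl)

    b-order : ∀ w → b ^ q · w ≈ w
    b-order = rel _ _ (there (here refl))

    abab : ∀ w → a ∷ b ∷ a ∷ b ∷ w ≈ w
    abab = rel _ _ (there (there (here refl)))

    b⁻a : ∀ w → b⁻ ∷ a ∷ w ≈ a ^ (3 + 2 * M * t) · b ^ (1 + C) · w
    b⁻a w = rel _ _ (there (there (there (here refl)))) w ⟫
      ≈-≡ (Listₚ.++-assoc (replicate (3 + 2 * M * t) a) (replicate (1 + C) b) w)

    a-commutes : ∀ w → a ^ (2 * M) · (b ∷ w) ≈ b ∷ a ^ (2 * M) · w
    a-commutes w = ≈-≡ (sym (Listₚ.++-assoc (replicate (2 * M) a) (b ∷ []) w)) ⟫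
      rel _ _ (there (there (there (there (there (here refl)))))) w

    inverse-as-power : ∀ l n → (∀ w → l ^ suc n · w ≈ w) → ∀ w → invL l ∷ w ≈ l ^ n · w
    inverse-as-power l n order w = ≈-sym (order (invL l ∷ w)) ⟫
      ≈-≡ (trans (cong (l ^_· (invL l ∷ w)) (ℕₚ.+-comm 1 n)) (^-+ l n 1 (invL l ∷ w))) ⟫
      ^-cong l n (cancel l w)

    a⁻-as-power : ∀ w → a⁻ ∷ w ≈ a ^ ℕ.pred p · w
    a⁻-as-power = inverse-as-power a (ℕ.pred p)
      (subst (λ n → ∀ w → a ^ n · w ≈ w) (sym (ℕₚ.suc-pred p)) a-order)

    b⁻-as-power : ∀ w → b⁻ ∷ w ≈ b ^ ℕ.pred q · w
    b⁻-as-power = inverse-as-power b (ℕ.pred q)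
      (subst (λ n → ∀ w → b ^ n · w ≈ w) (sym (ℕₚ.suc-pred q)) b-order)

    aE-b : ∀ s w → a ^ (2 * M * s) · (b ∷ w) ≈ b ∷ a ^ (2 * M * s) · w
    aE-b zero    w rewrite ℕₚ.*-zeroʳ (2 * M) = ≈-refl
    aE-b (suc s) w rewrite ℕₚ.*-suc (2 * M) s =
      ≈-≡ (^-+ a (2 * M) (2 * M * s) (b ∷ w)) ⟫
      ^-cong a (2 * M) (aE-b s w) ⟫ a-commutes _ ⟫
      ≈-cons b (≈-≡ (sym (^-+ a (2 * M) (2 * M * s) w)))

    aE-b^ : ∀ j s w → a ^ (2 * M * s) · b ^ j · w ≈ b ^ j · a ^ (2 * M * s) · w
    aE-b^ zero    s w = ≈-refl
    aE-b^ (suc j) s w = aE-b s (b ^ j · w) ⟫ ≈-cons b (aE-b^ j s w)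

    ab : ∀ w → a ∷ b ∷ w ≈ b⁻ ∷ a⁻ ∷ w
    ab w = ≈-sym (≈-cons a (≈-cons b (≈-cons a (cancel b (a⁻ ∷ w)) ⟫ cancel a w))) ⟫ abab (b⁻ ∷ a⁻ ∷ w)

    -- From abab = 1 comes aba = b⁻, so baa = a⁻(aba)a = a⁻b⁻a, and the fourth relation rewrites
    -- b⁻a.
    baa : ∀ w → b ∷ a ∷ a ∷ w ≈ a ^ (2 + 2 * M * t) · b ^ (1 + C) · w
    baa w = ≈-sym (cancel a⁻ (b ∷ a ∷ a ∷ w)) ⟫ ≈-cons a⁻ (aba (a ∷ w) ⟫ b⁻a w) ⟫ cancel a⁻ _
      where
      aba : ∀ w → a ∷ b ∷ a ∷ w ≈ b⁻ ∷ w
      aba w = ≈-sym (≈-cons a (≈-cons b (≈-cons a (cancel b w)))) ⟫ abab (b⁻ ∷ w)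

    -- Writing b as (baa)a⁻a⁻ turns `baa` into a conjugation rule: a⁻a⁻ moves right past b, while b
    -- becomes b^(1+C) and a power of a that commutes with b is left behind.
    a⁻a⁻b : ∀ w → a⁻ ∷ a⁻ ∷ b ∷ w ≈ b ^ (1 + C) · a ^ (2 * M * t) · (a⁻ ∷ a⁻ ∷ w)
    a⁻a⁻b w =
      ≈-cons a⁻ (≈-cons a⁻ (≈-cons b (≈-sym (≈-cons a (cancel a (a⁻ ∷ w)) ⟫ cancel a w)) ⟫
        baa (a⁻ ∷ a⁻ ∷ w)) ⟫ cancel a⁻ _) ⟫
      cancel a⁻ _ ⟫ aE-b^ (1 + C) t (a⁻ ∷ a⁻ ∷ w)

    a⁻a⁻b^ : ∀ y w → a⁻ ∷ a⁻ ∷ b ^ y · w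
                    ≈ b ^ (y * (1 + C)) · a ^ (2 * M * (y * t)) · (a⁻ ∷ a⁻ ∷ w)
    a⁻a⁻b^ zero    w rewrite ℕₚ.*-zeroʳ (2 * M) = ≈-refl
    a⁻a⁻b^ (suc y) w rewrite ℕₚ.*-distribˡ-+ (2 * M) t (y * t) =
      a⁻a⁻b (b ^ y · w) ⟫ ^-cong b (1 + C) (^-cong a (2 * M * t) (a⁻a⁻b^ y w) ⟫
        aE-b^ (y * (1 + C)) t _ ⟫
        ^-cong b (y * (1 + C)) (≈-≡ (sym (^-+ a (2 * M * t) (2 * M * (y * t)) _)))) ⟫
      ≈-≡ (sym (^-+ b (1 + C) (y * (1 + C)) _))

    HasNormalForm : Word → Set
    HasNormalForm w = Σ[ j ∈ ℕ ] Σ[ i ∈ ℕ ] w ≈ b ^ j · a ^ i · []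

    -- Induction on `j` through a b^(j+1) = (ab) b^j = b⁻a⁻ b^j = b⁻ a⁻a⁻ (a b^j). The bracket is
    -- the induction hypothesis, and a⁻a⁻ then moves right by `a⁻a⁻b^`; that rule concerns a⁻a⁻,
    -- which is why a letter a is inserted.
    prepend-a : ∀ j i → HasNormalForm (a ∷ b ^ j · a ^ i · [])
    prepend-a zero    i = 0 , suc i , ≈-refl
    prepend-a (suc j) i with prepend-a j i
    ... | j′ , i′ , e = r + s , x + (y + (y + i′)) ,
        (ab _ ⟫ ≈-cons b⁻ (≈-cons a⁻ (≈-sym (cancel a⁻ _) ⟫ ≈-cons a⁻ e) ⟫ a⁻a⁻b^ j′ (a ^ i′ · [])) ⟫
         b⁻-as-power _ ⟫ ≈-≡ (sym (^-+ b r s _)) ⟫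
         ^-cong b (r + s) (^-cong a x (a⁻-as-power _ ⟫ ^-cong a y (a⁻-as-power _ ⟫ ≈-≡ (sym (^-+ a y i′ [])))
           ⟫ ≈-≡ (sym (^-+ a y (y + i′) []))) ⟫ ≈-≡ (sym (^-+ a x (y + (y + i′)) []))))
      where
      -- The letter b⁻ costs q - 1 letters b, and each of the two letters a⁻ costs p - 1 letters a.
      r = ℕ.pred q
      s = j′ * (1 + C)
      x = 2 * M * (j′ * t)
      y = ℕ.pred p

    prepend-a^ : ∀ n {w} → HasNormalForm w → HasNormalForm (a ^ n · w)
    prepend-a^ zero    nf = nf
    prepend-a^ (suc n) nf with prepend-a^ n nf
    ... | j , i , e with prepend-a j i
    ... | j′ , i′ , e′ = j′ , i′ , (≈-cons a e ⟫ e′)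

    prepend-b^ : ∀ n {w} → HasNormalForm w → HasNormalForm (b ^ n · w)
    prepend-b^ n (j , i , e) = n + j , i , (^-cong b n e ⟫ ≈-≡ (sym (^-+ b n j _)))

    normalise : ∀ w → HasNormalForm w
    normalise [] = 0 , 0 , ≈-refl
    normalise ((σ₁ , true)  ∷ w) = prepend-a^ 1 (normalise w)
    normalise ((σ₂ , true)  ∷ w) = prepend-b^ 1 (normalise w)
    normalise ((σ₁ , false) ∷ w) with prepend-a^ (ℕ.pred p) (normalise w)
    ... | j , i , e = j , i , (a⁻-as-power w ⟫ e)
    normalise ((σ₂ , false) ∷ w) with prepend-b^ (ℕ.pred q) (normalise w)
    ... | j , i , e = j , i , (b⁻-as-power w ⟫ e)

    power-multiple : ∀ l n → (∀ w → l ^ n · w ≈ w) → ∀ k w → l ^ (k * n) · w ≈ w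
    power-multiple l n order zero    w = ≈-refl
    power-multiple l n order (suc k) w =
      ≈-≡ (^-+ l n (k * n) w) ⟫ order _ ⟫ power-multiple l n order k w

    power-% : ∀ l n {{_ : NonZero n}} → (∀ w → l ^ n · w ≈ w) → ∀ i w → l ^ i · w ≈ l ^ (i ℕ.% n) · w
    power-% l n order i w = ≈-≡ (trans (cong (l ^_· w) (ℕ.m≡m%n+[m/n]*n i n)) (^-+ l (i ℕ.% n) _ w)) ⟫
      ^-cong l (i ℕ.% n) (power-multiple l n order (i ℕ./ n) w)

    -- With `normalise` this bounds the order of the presented group by p q.
    normal-forms-≈ : ∀ {i i′ j j′} → i ℕ.% p ≡ i′ ℕ.% p → j ℕ.% q ≡ j′ ℕ.% q →
                     b ^ j · a ^ i · [] ≈ b ^ j′ · a ^ i′ · []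
    normal-forms-≈ {i} {i′} {j} {j′} eqᵢ eqⱼ =
      power-% b q b-order j _ ⟫ ≈-≡ (cong (b ^_· _) eqⱼ) ⟫ ≈-sym (power-% b q b-order j′ _) ⟫
      ^-cong b j′ (power-% a p a-order i [] ⟫ ≈-≡ (cong (a ^_· []) eqᵢ) ⟫ ≈-sym (power-% a p a-order i′ []))

open Presentations

-- The polyhedron

module Model (A B : ℕ) {{_ : NonZero A}} {{_ : NonZero B}} (u : ℤ) (A∣B : + A ∣ℤ + B)
  (B∣u² : + B ∣ℤ u ℤ.* u) (B∣uA : + B ∣ℤ u ℤ.* + A)
  (B∤2 : ¬ (+ B ∣ℤ + 2)) (B∤8u : ¬ (+ B ∣ℤ + 8 ℤ.* u)) where
  open import Data.Integer using (_+_; _-_; _*_; -_)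

  -- Coordinates for vertices, edges and faces

  A∣u² : + A ∣ℤ u * u
  A∣u² = ℤ∣.∣-trans A∣B B∣u²

  -- Vertex coordinates live modulo A and face coordinates modulo B. Since B divides uA, a term u·a
  -- is nevertheless well defined in a face coordinate; for the opposite passage A ∣ B suffices.
  u-scale : ∀ {a b} → a ≈ b [ A ] → u * a ≈ u * b [ B ]
  u-scale {a} {b} (mod (ℤ∣.divides t eq)) = by-multiple t B∣uA
    (trans (lem₁ u a b) (trans (cong (u *_) eq) (lem₂ u t (+ A))))
    where
    lem₁ : ∀ u a b → u * a - u * b ≡ u * (a - b)
    lem₁ = solve-∀
    lem₂ : ∀ u t x → u * (t * x) ≡ t * (u * x)
    lem₂ = solve-∀

  -- The edge (a , f) joins V₀ a to V₁ (far a f) and lies on the faces f and next a f.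
  far next : ℤ → ℤ → ℤ
  far a f = a - f - + 1 - + 4 * (u * a) * f + u * f * (f + + 1)
  next a f = f + + 1 - + 4 * (u * a)

  far-cong : ∀ {a a′ f f′} → a ≈ a′ [ A ] → f ≈ f′ [ A ] → far a f ≈ far a′ f′ [ A ]
  far-cong p q = +-≈ (∸-≈ (+-≈ʳ (- + 1) (∸-≈ p q)) (*-≈ (*-≈ˡ (+ 4) (*-≈ˡ u p)) q))
                     (*-≈ (*-≈ˡ u q) (+-≈ʳ (+ 1) q))

  next-cong : ∀ {a a′ f f′} → a ≈ a′ [ A ] → f ≈ f′ [ B ] → next a f ≈ next a′ f′ [ B ]
  next-cong p q = ∸-≈ (+-≈ʳ (+ 1) q) (*-≈ˡ (+ 4) (u-scale p))

  opaque
    V₀ V₁ : ℤ → Fin (A ℕ.+ A)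
    V₀ a = residue a ↑ˡ A
    V₁ a = A ↑ʳ residue a

    V₀-cong : ∀ {a b} → a ≈ b [ A ] → V₀ a ≡ V₀ b
    V₀-cong p = cong (_↑ˡ A) (residue-cong p)

    V₁-cong : ∀ {a b} → a ≈ b [ A ] → V₁ a ≡ V₁ b
    V₁-cong p = cong (A ↑ʳ_) (residue-cong p)

    V₀-injective : ∀ {a b} → V₀ a ≡ V₀ b → a ≈ b [ A ]
    V₀-injective eq = residue-injective (Finₚ.↑ˡ-injective A _ _ eq)

    V₁-injective : ∀ {a b} → V₁ a ≡ V₁ b → a ≈ b [ A ]
    V₁-injective eq = residue-injective (Finₚ.↑ʳ-injective A _ _ eq)

    V₀≢V₁ : ∀ {a b} → V₀ a ≢ V₁ b
    V₀≢V₁ {a} {b} eq with trans (sym (Finₚ.splitAt-↑ˡ A (residue a) A))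
      (trans (cong (splitAt A) eq) (Finₚ.splitAt-↑ʳ A A (residue b)))
    ... | ()

  face : ℤ → Fin B
  face = residue {B}

  face-cong : ∀ {a b} → a ≈ b [ B ] → face a ≡ face b
  face-cong = residue-cong

  data VertexView : Fin (A ℕ.+ A) → Set where
    even : ∀ n → VertexView (V₀ (+ n))
    odd  : ∀ n → VertexView (V₁ (+ n))

  opaque
    unfolding V₀

    vertexView : ∀ v → VertexView v
    vertexView v with splitAt A v in eq
    ... | inj₁ x = subst VertexView (trans (cong (_↑ˡ A) (residue-rep x)) (Finₚ.splitAt⁻¹-↑ˡ eq))
        (even (Fin.toℕ x))
    ... | inj₂ x = subst VertexView (trans (cong (A ↑ʳ_) (residue-rep x)) (Finₚ.splitAt⁻¹-↑ʳ eq))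
        (odd (Fin.toℕ x))

  data FaceView : Fin B → Set where
    mkFace : ∀ n → FaceView (face (+ n))

  faceView : ∀ f → FaceView f
  faceView f = subst FaceView (residue-rep f) (mkFace (Fin.toℕ f))

  opaque
    edge : ℤ → ℤ → Fin (A ℕ.* B)
    edge a f = combine {A} {B} (residue a) (residue f)

    edge-cong : ∀ {a b f g} → a ≈ b [ A ] → f ≈ g [ B ] → edge a f ≡ edge b g
    edge-cong p q = cong₂ (combine {A} {B}) (residue-cong p) (residue-cong q)

    coordV : Fin (A ℕ.* B) → ℤ
    coordV e = rep (proj₁ (remQuot {A} B e))

    coordF : Fin (A ℕ.* B) → ℤ
    coordF e = rep (proj₂ (remQuot {A} B e))

    coordV-edge : ∀ a f → coordV (edge a f) ≈ a [ A ]
    coordV-edge a f = subst (λ x → rep (proj₁ x) ≈ a [ A ])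
      (sym (Finₚ.remQuot-combine {A} {B} (residue a) (residue f))) (rep-residue a)

    coordF-edge : ∀ a f → coordF (edge a f) ≈ f [ B ]
    coordF-edge a f = subst (λ x → rep (proj₂ x) ≈ f [ B ])
      (sym (Finₚ.remQuot-combine {A} {B} (residue a) (residue f))) (rep-residue f)

    edge-η : ∀ e → edge (coordV e) (coordF e) ≡ e
    edge-η e = trans (cong₂ (combine {A} {B}) (residue-rep (proj₁ (remQuot {A} B e)))
      (residue-rep (proj₂ (remQuot {A} B e)))) (Finₚ.combine-remQuot {A} B e)

    edge-injective : ∀ {a b f g} → edge a f ≡ edge b g → a ≈ b [ A ] × f ≈ g [ B ]
    edge-injective eq with Finₚ.combine-injective {A} {B} _ _ _ _ eq
    ... | p , q = residue-injective p , residue-injective q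

  data EdgeView : Fin (A ℕ.* B) → Set where
    mkEdge : ∀ m n → EdgeView (edge (+ m) (+ n))

  opaque
    unfolding coordV

    edgeView : ∀ e → EdgeView e
    edgeView e = subst EdgeView (edge-η e)
      (mkEdge (Fin.toℕ (proj₁ (remQuot {A} B e))) (Fin.toℕ (proj₂ (remQuot {A} B e))))

  end₀ end₁ : Fin (A ℕ.* B) → Fin (A ℕ.+ A)
  end₀ e = V₀ (coordV e)
  end₁ e = V₁ (far (coordV e) (coordF e))

  side₀ side₁ : Fin (A ℕ.* B) → Fin B
  side₀ e = face (coordF e)
  side₁ e = face (next (coordV e) (coordF e))

  end₀-edge : ∀ a f → end₀ (edge a f) ≡ V₀ a
  end₀-edge a f = V₀-cong (coordV-edge a f)

  end₁-edge : ∀ a f → end₁ (edge a f) ≡ V₁ (far a f)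
  end₁-edge a f = V₁-cong (far-cong (coordV-edge a f) (≈-weaken A∣B (coordF-edge a f)))

  side₀-edge : ∀ a f → side₀ (edge a f) ≡ face f
  side₀-edge a f = face-cong (coordF-edge a f)

  side₁-edge : ∀ a f → side₁ (edge a f) ≡ face (next a f)
  side₁-edge a f = face-cong (next-cong (coordV-edge a f) (coordF-edge a f))

  -- Incidence and the diamond condition

  opaque
    oneOf : ∀ {n} → Fin n → Fin n → Fin n → Bool
    oneOf y z x = ⌊ x Fin.≟ y ⌋ ∨ ⌊ x Fin.≟ z ⌋

    oneOf-intro : ∀ {n} {x y z : Fin n} → x ≡ y ⊎ x ≡ z → T (oneOf y z x)
    oneOf-intro {x = x} {y} (inj₁ p) = Equivalence.from (Boolₚ.T-∨ {⌊ x Fin.≟ y ⌋}) (inj₁ (fromWitness p))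
    oneOf-intro {x = x} {y} (inj₂ p) = Equivalence.from (Boolₚ.T-∨ {⌊ x Fin.≟ y ⌋}) (inj₂ (fromWitness p))

    oneOf-elim : ∀ {n} {x y z : Fin n} → T (oneOf y z x) → x ≡ y ⊎ x ≡ z
    oneOf-elim {x = x} {y} {z} t with Equivalence.to (Boolₚ.T-∨ {⌊ x Fin.≟ y ⌋}) t
    ... | inj₁ p = inj₁ (toWitness {a? = x Fin.≟ y} p)
    ... | inj₂ p = inj₂ (toWitness {a? = x Fin.≟ z} p)

    oneOf-image : ∀ {n} (h h⁻ : Fin n → Fin n) → (∀ x → h⁻ (h x) ≡ x) → ∀ x y z →
                  oneOf (h y) (h z) (h x) ≡ oneOf y z x
    oneOf-image h h⁻ inv x y z = cong₂ _∨_ (same x y) (same x z)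
      where
      same : ∀ x y → ⌊ h x Fin.≟ h y ⌋ ≡ ⌊ x Fin.≟ y ⌋
      same x y with h x Fin.≟ h y | x Fin.≟ y
      ... | yes _  | yes _    = refl
      ... | no _   | no _     = refl
      ... | yes eq | no ne    = ⊥-elim (ne (trans (sym (inv x)) (trans (cong h⁻ eq) (inv y))))
      ... | no ne  | yes refl = ⊥-elim (ne refl)

    oneOf-swap : ∀ {n} (y z x : Fin n) → oneOf y z x ≡ oneOf z y x
    oneOf-swap y z x = Boolₚ.∨-comm ⌊ x Fin.≟ y ⌋ ⌊ x Fin.≟ z ⌋

  incidence : Incidence
  incidence = record
    { nV = A ℕ.+ A ; nE = A ℕ.* B ; nF = B
    ; IVE = λ v e → oneOf (end₀ e) (end₁ e) v
    ; IEF = λ e f → oneOf (side₀ e) (side₁ e) f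
    -- A tight polyhedron of type {2A , B} has 2A vertices and B faces, all mutually incident.
    ; IVF = λ _ _ → true }

  open Incidence incidence using (IVE; IEF)

  V₀-on : ∀ a f → T (IVE (V₀ a) (edge a f))
  V₀-on a f = oneOf-intro (inj₁ (sym (end₀-edge a f)))

  V₁-on : ∀ {x} a f → far a f ≈ x [ A ] → T (IVE (V₁ x) (edge a f))
  V₁-on a f p = oneOf-intro (inj₂ (trans (V₁-cong (≈-symm p)) (sym (end₁-edge a f))))

  face₀-on : ∀ a f → T (IEF (edge a f) (face f))
  face₀-on a f = oneOf-intro (inj₁ (sym (side₀-edge a f)))

  face₁-on : ∀ {x} a f → next a f ≈ x [ B ] → T (IEF (edge a f) (face x))
  face₁-on a f p = oneOf-intro (inj₂ (trans (face-cong (≈-symm p)) (sym (side₁-edge a f))))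

  end₀-elim : ∀ {a} e → T (IVE (V₀ a) e) → coordV e ≈ a [ A ]
  end₀-elim e t with oneOf-elim t
  ... | inj₁ eq = ≈-symm (V₀-injective eq)
  ... | inj₂ eq = ⊥-elim (V₀≢V₁ eq)

  end₁-elim : ∀ {a} e → T (IVE (V₁ a) e) → far (coordV e) (coordF e) ≈ a [ A ]
  end₁-elim e t with oneOf-elim t
  ... | inj₁ eq = ⊥-elim (V₀≢V₁ (sym eq))
  ... | inj₂ eq = ≈-symm (V₁-injective eq)

  side-elim : ∀ {f} e → T (IEF e (face f)) → coordF e ≈ f [ B ] ⊎ next (coordV e) (coordF e) ≈ f [ B ]
  side-elim e t with oneOf-elim t
  ... | inj₁ eq = inj₁ (≈-symm (residue-injective eq))
  ... | inj₂ eq = inj₂ (≈-symm (residue-injective eq))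

  B∤1 : ¬ (+ B ∣ℤ + 1)
  B∤1 p = B∤2 (ℤ∣.∣n⇒∣m*n (+ 2) p)

  -- Equality would make 1 - 4ua vanish modulo B, but it is a unit with inverse 1 + 4ua.
  next-moves : ∀ a f → ¬ (f ≈ next a f [ B ])
  next-moves a f (mod p) = B∤1 (subst (+ B ∣ℤ_) (lem u a f)
      (ℤ∣.∣m∣n⇒∣m+n (ℤ∣.∣n⇒∣m*n (- (+ 1 + + 4 * (u * a))) p) (ℤ∣.∣n⇒∣m*n (+ 16 * a * a) B∣u²)))
    where
    lem : ∀ u a f → (- (+ 1 + + 4 * (u * a))) * (f - (f + + 1 - + 4 * (u * a))) + + 16 * a * a * (u * u) ≡ + 1
    lem = solve-∀

  edge-verts : ∀ e → ExactlyTwo (λ v → T (IVE v e))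
  edge-verts e = end₀ e , end₁ e , V₀≢V₁ , oneOf-intro (inj₁ refl) , oneOf-intro (inj₂ refl) , λ _ → oneOf-elim

  edge-faces : ∀ e → ExactlyTwo (λ f → T (IEF e f))
  edge-faces e = side₀ e , side₁ e , next-moves (coordV e) (coordF e) ∘ residue-injective ,
    oneOf-intro (inj₁ refl) , oneOf-intro (inj₂ refl) , λ _ → oneOf-elim

  prev : ℤ → ℤ → ℤ
  prev a f = f - + 1 + + 4 * (u * a)

  prev-cong : ∀ {a a′ f f′} → a ≈ a′ [ A ] → f ≈ f′ [ B ] → prev a f ≈ prev a′ f′ [ B ]
  prev-cong p q = +-≈ (+-≈ʳ (- + 1) q) (*-≈ˡ (+ 4) (u-scale p))

  next-prev : ∀ a f → next a (prev a f) ≡ f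
  next-prev = lem u
    where
    lem : ∀ u a f → f - + 1 + + 4 * (u * a) + + 1 - + 4 * (u * a) ≡ f
    lem = solve-∀

  prev-next : ∀ a f → prev a (next a f) ≡ f
  prev-next = lem u
    where
    lem : ∀ u a f → f + + 1 - + 4 * (u * a) - + 1 + + 4 * (u * a) ≡ f
    lem = solve-∀

  -- The edges at V₁ x and face f are (near₀ x f , f) and (near₁ x f , prev (near₁ x f) f).
  near₀ : ℤ → ℤ → ℤ
  near₀ x f = (x + f + + 1) * (+ 1 + + 4 * (u * f)) - u * f * (f + + 1)

  near₀-cong : ∀ {a a′ f f′} → a ≈ a′ [ A ] → f ≈ f′ [ A ] → near₀ a f ≈ near₀ a′ f′ [ A ]
  near₀-cong p q = ∸-≈ (*-≈ (+-≈ʳ (+ 1) (+-≈ p q)) (+-≈ (≈-rfl {a = + 1}) (*-≈ˡ (+ 4) (*-≈ˡ u q))))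
                      (*-≈ (*-≈ˡ u q) (+-≈ʳ (+ 1) q))

  -- The first argument of by-multiple is here the quotient by u², as for all congruences below.
  far-near₀ : ∀ x f → far (near₀ x f) f ≈ x [ A ]
  far-near₀ x f = by-multiple (- (+ 12) * f * f * f - + 16 * f * f * x - + 12 * f * f) A∣u² (lem u x f)
    where
    lem : ∀ u x f →
      let a = (x + f + + 1) * (+ 1 + + 4 * (u * f)) - u * f * (f + + 1) in
      a - f - + 1 - + 4 * (u * a) * f + u * f * (f + + 1) - x
        ≡ (- (+ 12) * f * f * f - + 16 * f * f * x - + 12 * f * f) * (u * u)
    lem = solve-∀

  near₀-far : ∀ a f → near₀ (far a f) f ≈ a [ A ]
  near₀-far a f = by-multiple (- (+ 16) * a * f * f + + 4 * f * f * f + + 4 * f * f) A∣u² (lem u a f)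
    where
    lem : ∀ u a f →
      let x = a - f - + 1 - + 4 * (u * a) * f + u * f * (f + + 1) in
      (x + f + + 1) * (+ 1 + + 4 * (u * f)) - u * f * (f + + 1) - a
        ≡ (- (+ 16) * a * f * f + + 4 * f * f * f + + 4 * f * f) * (u * u)
    lem = solve-∀

  near₁ : ℤ → ℤ → ℤ
  near₁ x f = (x + f) * (+ 1 + + 4 * (u * f)) - u * f * (f - + 1)

  near₁-cong : ∀ {a a′ f f′} → a ≈ a′ [ A ] → f ≈ f′ [ A ] → near₁ a f ≈ near₁ a′ f′ [ A ]
  near₁-cong p q = ∸-≈ (*-≈ (+-≈ p q) (+-≈ (≈-rfl {a = + 1}) (*-≈ˡ (+ 4) (*-≈ˡ u q))))
                       (*-≈ (*-≈ˡ u q) (+-≈ʳ (- + 1) q))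

  far-near₁ : ∀ x f → far (near₁ x f) (prev (near₁ x f) f) ≈ x [ A ]
  far-near₁ x f = ≈-tran
    (far-cong {f = prev (near₁ x f) f} {f′ = f - + 1 + + 4 * (u * (x + f))} (≈-rfl {a = near₁ x f})
      (by-multiple (+ 12 * f * f + + 16 * f * x + + 4 * f) A∣u² (lem₁ u x f)))
    (by-multiple (- (+ 48) * f * f * f * u - + 112 * f * f * u * x - + 64 * f * u * x * x - + 12 * f * f * f
      - + 16 * f * f * x + + 16 * f * u * x + + 16 * u * x * x - + 8 * f * x - + 16 * x * x - + 4 * x)
      A∣u² (lem₂ u x f))
    where
    lem₁ : ∀ u x f → f - + 1 + + 4 * (u * ((x + f) * (+ 1 + + 4 * (u * f)) - u * f * (f - + 1)))
        - (f - + 1 + + 4 * (u * (x + f))) ≡ (+ 12 * f * f + + 16 * f * x + + 4 * f) * (u * u)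
    lem₁ = solve-∀
    lem₂ : ∀ u x f →
      let a = (x + f) * (+ 1 + + 4 * (u * f)) - u * f * (f - + 1)
          g = f - + 1 + + 4 * (u * (x + f)) in
      a - g - + 1 - + 4 * (u * a) * g + u * g * (g + + 1) - x
        ≡ (- (+ 48) * f * f * f * u - + 112 * f * f * u * x - + 64 * f * u * x * x - + 12 * f * f * f
      - + 16 * f * f * x + + 16 * f * u * x + + 16 * u * x * x - + 8 * f * x - + 16 * x * x - + 4 * x) * (u * u)
    lem₂ = solve-∀

  near₁-far : ∀ a f → near₁ (far a f) (next a f) ≈ a [ A ]
  near₁-far a f = by-multiple (+ 64 * a * a * f * u - + 16 * a * f * f * u + + 48 * a * a * u - + 16 * a * f * f
      - + 16 * a * f * u + + 4 * f * f * f - + 16 * a * a - + 24 * a * f + + 8 * f * f - + 12 * a + + 4 * f)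
      A∣u² (lem u a f)
    where
    lem : ∀ u a f →
      let x = a - f - + 1 - + 4 * (u * a) * f + u * f * (f + + 1)
          g = f + + 1 - + 4 * (u * a) in
      (x + g) * (+ 1 + + 4 * (u * g)) - u * g * (g - + 1) - a
        ≡ (+ 64 * a * a * f * u - + 16 * a * f * f * u + + 48 * a * a * u - + 16 * a * f * f
      - + 16 * a * f * u + + 4 * f * f * f - + 16 * a * a - + 24 * a * f + + 8 * f * f - + 12 * a + + 4 * f)
          * (u * u)
    lem = solve-∀

  edge-by-coords : ∀ {a f} e → coordV e ≈ a [ A ] → coordF e ≈ f [ B ] → e ≡ edge a f
  edge-by-coords e p q = trans (sym (edge-η e)) (edge-cong p q)

  edge-by-next : ∀ {a f} e → coordV e ≈ a [ A ] → next (coordV e) (coordF e) ≈ f [ B ] → e ≡ edge a (prev a f)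
  edge-by-next e p q = edge-by-coords e p
    (≈-tran (≈-reflexive (sym (prev-next (coordV e) (coordF e)))) (prev-cong p q))

  edge-at-V₁-face₀ : ∀ {x f} e → T (IVE (V₁ x) e) → coordF e ≈ f [ B ] → e ≡ edge (near₀ x f) f
  edge-at-V₁-face₀ e t q = edge-by-coords e
    (≈-tran (≈-symm (near₀-far _ _)) (near₀-cong (end₁-elim e t) (≈-weaken A∣B q))) q

  edge-at-V₁-face₁ : ∀ {x f} e → T (IVE (V₁ x) e) → next (coordV e) (coordF e) ≈ f [ B ] →
                     e ≡ edge (near₁ x f) (prev (near₁ x f) f)
  edge-at-V₁-face₁ e t q = edge-by-next e
    (≈-tran (≈-symm (near₁-far _ _)) (near₁-cong (end₁-elim e t) (≈-weaken A∣B q))) q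

  face₁-on-prev : ∀ a f → T (IEF (edge a (prev a f)) (face f))
  face₁-on-prev a f = face₁-on a (prev a f) (≈-reflexive (next-prev a f))

  -- The face f is the first side of one edge and the second side of the other; if the edges were
  -- equal it would be both, against `next-moves`.
  side-roles-differ : ∀ {a b g f} → next b g ≈ f [ B ] → edge a f ≢ edge b g
  side-roles-differ {b = b} {g} q eq = next-moves b g
    (≈-tran (≈-symm (proj₂ (edge-injective eq))) (≈-symm q))

  diamond : ∀ v f → ExactlyTwo (λ e → T (IVE v e) × T (IEF e f))
  diamond v f with vertexView v | faceView f
  ... | even m | mkFace n = edge a g , edge a (prev a g) ,
      side-roles-differ (≈-reflexive (next-prev a g)) ,
      (V₀-on a g , face₀-on a g) , (V₀-on a (prev a g) , face₁-on-prev a g) ,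
      λ e (ve , ef) → [ inj₁ ∘ edge-by-coords e (end₀-elim e ve)
                      , inj₂ ∘ edge-by-next e (end₀-elim e ve) ]′ (side-elim e ef)
    where a = + m
          g = + n
  ... | odd m  | mkFace n = edge a₀ g , edge a₁ (prev a₁ g) ,
      side-roles-differ (≈-reflexive (next-prev a₁ g)) ,
      (V₁-on a₀ g (far-near₀ x g) , face₀-on a₀ g) ,
      (V₁-on a₁ (prev a₁ g) (far-near₁ x g) , face₁-on-prev a₁ g) ,
      λ e (ve , ef) → [ inj₁ ∘ edge-at-V₁-face₀ e ve , inj₂ ∘ edge-at-V₁-face₁ e ve ]′ (side-elim e ef)
    where x  = + m
          g  = + n
          a₀ = near₀ x g
          a₁ = near₁ x g

  -- Valencies of faces and vertices

  onV : {X : Set} → (ℤ → X) → (ℤ → X) → Fin (A ℕ.+ A) → X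
  onV p q v with vertexView v
  ... | even m = p (+ m)
  ... | odd m  = q (+ m)

  Respects : ℕ → {X : Set} → (ℤ → X) → Set
  Respects n p = ∀ {a b} → a ≈ b [ n ] → p a ≡ p b

  onV-V₀ : ∀ {X : Set} (p q : ℤ → X) → Respects A p → ∀ a → onV p q (V₀ a) ≡ p a
  onV-V₀ p q p-resp a = at (V₀ a) refl
    where
    at : ∀ v → v ≡ V₀ a → onV p q v ≡ p a
    at v eq with vertexView v
    ... | even m = p-resp (V₀-injective eq)
    ... | odd m  = ⊥-elim (V₀≢V₁ (sym eq))

  onV-V₁ : ∀ {X : Set} (p q : ℤ → X) → Respects A q → ∀ a → onV p q (V₁ a) ≡ q a
  onV-V₁ p q q-resp a = at (V₁ a) refl
    where
    at : ∀ v → v ≡ V₁ a → onV p q v ≡ q a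
    at v eq with vertexView v
    ... | even m = ⊥-elim (V₀≢V₁ eq)
    ... | odd m  = q-resp (V₁-injective eq)

  -- For each a modulo A the face is the first side of one edge with vertex coordinate a and the
  -- second side of another; `Fin (A + A)`, already two copies of ℤ/A, serves as the index set.
  edges-at-face : ∀ f → count (λ e → IEF e f) ≡ A ℕ.+ A
  edges-at-face f with faceView f
  ... | mkFace n = count-by-bijection (λ e → IEF e (face g)) at at-sound at-injective at-onto
    where
    g = + n
    other : ℤ → Fin (A ℕ.* B)
    other a = edge a (prev a g)
    other-resp : Respects A other
    other-resp p = edge-cong p (prev-cong p (≈-rfl {a = g}))
    at : Fin (A ℕ.+ A) → Fin (A ℕ.* B)
    at = onV (λ a → edge a g) other
    at-sound : ∀ v → T (IEF (at v) (face g))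
    at-sound v with vertexView v
    ... | even m = face₀-on (+ m) g
    ... | odd m  = face₁-on-prev (+ m) g
    at-injective : ∀ {v w} → at v ≡ at w → v ≡ w
    at-injective {v} {w} eq with vertexView v | vertexView w
    ... | even m | even n = V₀-cong (proj₁ (edge-injective eq))
    ... | odd m  | odd n  = V₁-cong (proj₁ (edge-injective eq))
    ... | even m | odd n  = ⊥-elim (side-roles-differ (≈-reflexive (next-prev (+ n) g)) eq)
    ... | odd m  | even n = ⊥-elim (side-roles-differ (≈-reflexive (next-prev (+ m) g)) (sym eq))
    at-onto : ∀ e → T (IEF e (face g)) → Σ[ v ∈ _ ] at v ≡ e
    at-onto e t with side-elim e t
    ... | inj₁ p = V₀ (coordV e) ,
        trans (onV-V₀ (λ a → edge a g) other (λ p → edge-cong p ≈-rfl) (coordV e))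
          (sym (edge-by-coords e ≈-rfl p))
    ... | inj₂ p = V₁ (coordV e) ,
        trans (onV-V₁ (λ a → edge a g) other other-resp (coordV e)) (sym (edge-by-next e ≈-rfl p))

  -- Exactly one edge at a given vertex has a given face as its first side, so the B faces index the
  -- edges.
  edges-at-vertex : ∀ v → count (IVE v) ≡ B
  edges-at-vertex v with vertexView v
  ... | even m = count-by-bijection (IVE (V₀ a)) (λ f → edge a (rep f)) (λ f → V₀-on a (rep f))
      (λ {i} {j} eq → trans (sym (residue-rep i))
        (trans (residue-cong (proj₂ (edge-injective eq))) (residue-rep j)))
      (λ e t → face (coordF e) , sym (edge-by-coords e (end₀-elim e t) (≈-symm (rep-residue (coordF e)))))
    where a = + m
  ... | odd m = count-by-bijection (IVE (V₁ x)) (λ f → edge (near₀ x (rep f)) (rep f))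
      (λ f → V₁-on (near₀ x (rep f)) (rep f) (far-near₀ x (rep f)))
      (λ {i} {j} eq → trans (sym (residue-rep i))
        (trans (residue-cong (proj₂ (edge-injective eq))) (residue-rep j)))
      (λ e t → face (coordF e) , sym (edge-at-V₁-face₀ e t (≈-symm (rep-residue (coordF e)))))
    where x = + m

  -- ρ is the action of σ₁ on faces; turn and turn⁻ are ρ (next a f) and ρ⁻ (next a f) reduced modulo u².
  ρ ρ⁻ : ℤ → ℤ
  ρ f  = - f - + 2 * (u * f) * (f - + 1)
  ρ⁻ f = - f - + 2 * (u * f) * (f + + 1)

  ρ-cong : ∀ {f g} → f ≈ g [ B ] → ρ f ≈ ρ g [ B ]
  ρ-cong p = ∸-≈ (neg-≈ p) (*-≈ (*-≈ˡ (+ 2) (*-≈ˡ u p)) (+-≈ʳ (- + 1) p))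

  ρ⁻-cong : ∀ {f g} → f ≈ g [ B ] → ρ⁻ f ≈ ρ⁻ g [ B ]
  ρ⁻-cong p = ∸-≈ (neg-≈ p) (*-≈ (*-≈ˡ (+ 2) (*-≈ˡ u p)) (+-≈ʳ (+ 1) p))

  ρ⁻-ρ : ∀ f → ρ⁻ (ρ f) ≈ f [ B ]
  ρ⁻-ρ f = by-multiple (- (+ 8) * f * f * f * f * u + + 16 * f * f * f * u - + 8 * f * f * f
      - + 8 * f * f * u + + 12 * f * f - + 4 * f) B∣u² (lem u f)
    where
    lem : ∀ u f → let g = - f - + 2 * (u * f) * (f - + 1) in
      - g - + 2 * (u * g) * (g + + 1) - f ≡ (- (+ 8) * f * f * f * f * u + + 16 * f * f * f * u
      - + 8 * f * f * f - + 8 * f * f * u + + 12 * f * f - + 4 * f) * (u * u)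
    lem = solve-∀

  ρ-ρ⁻ : ∀ f → ρ (ρ⁻ f) ≈ f [ B ]
  ρ-ρ⁻ f = by-multiple (- (+ 8) * f * f * f * f * u - + 16 * f * f * f * u - + 8 * f * f * f
      - + 8 * f * f * u - + 12 * f * f - + 4 * f) B∣u² (lem u f)
    where
    lem : ∀ u f → let g = - f - + 2 * (u * f) * (f + + 1) in
      - g - + 2 * (u * g) * (g - + 1) - f ≡ (- (+ 8) * f * f * f * f * u - + 16 * f * f * f * u
      - + 8 * f * f * f - + 8 * f * f * u - + 12 * f * f - + 4 * f) * (u * u)
    lem = solve-∀

  turn turn⁻ : ℤ → ℤ → ℤ
  turn a f  = - f - + 1 + + 4 * (u * a) - + 2 * (u * f) * (f + + 1)
  turn⁻ a f = - f - + 1 + + 4 * (u * a) - + 2 * (u * (f + + 1)) * (f + + 2)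

  turn-cong : ∀ {a a′ f f′} → a ≈ a′ [ A ] → f ≈ f′ [ B ] → turn a f ≈ turn a′ f′ [ B ]
  turn-cong p q = ∸-≈ (+-≈ (+-≈ʳ (- + 1) (neg-≈ q)) (*-≈ˡ (+ 4) (u-scale p)))
                      (*-≈ (*-≈ˡ (+ 2) (*-≈ˡ u q)) (+-≈ʳ (+ 1) q))

  turn⁻-cong : ∀ {a a′ f f′} → a ≈ a′ [ A ] → f ≈ f′ [ B ] → turn⁻ a f ≈ turn⁻ a′ f′ [ B ]
  turn⁻-cong p q = ∸-≈ (+-≈ (+-≈ʳ (- + 1) (neg-≈ q)) (*-≈ˡ (+ 4) (u-scale p)))
                       (*-≈ (*-≈ˡ (+ 2) (*-≈ˡ u (+-≈ʳ (+ 1) q))) (+-≈ʳ (+ 2) q))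

  ρ-next : ∀ a f → ρ (next a f) ≈ turn a f [ B ]
  ρ-next a f = by-multiple (- (+ 32) * a * a * u + + 16 * a * f + + 8 * a) B∣u² (lem u a f)
    where
    lem : ∀ u a f → let g = f + + 1 - + 4 * (u * a) in
      - g - + 2 * (u * g) * (g - + 1) - (- f - + 1 + + 4 * (u * a) - + 2 * (u * f) * (f + + 1))
        ≡ (- (+ 32) * a * a * u + + 16 * a * f + + 8 * a) * (u * u)
    lem = solve-∀

  ρ⁻-next : ∀ a f → ρ⁻ (next a f) ≈ turn⁻ a f [ B ]
  ρ⁻-next a f = by-multiple (- (+ 32) * a * a * u + + 16 * a * f + + 24 * a) B∣u² (lem u a f)
    where
    lem : ∀ u a f → let g = f + + 1 - + 4 * (u * a) in
      - g - + 2 * (u * g) * (g + + 1) - (- f - + 1 + + 4 * (u * a) - + 2 * (u * (f + + 1)) * (f + + 2))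
        ≡ (- (+ 32) * a * a * u + + 16 * a * f + + 24 * a) * (u * u)
    lem = solve-∀

  -- σ₁ takes the first end `V₀ a` to `V₁ a`, which has to be the second end of the image edge;
  -- `next-turn` is the analogue for sides.
  far-turn : ∀ a f → far (far a f + + 1) (turn a f) ≈ a [ A ]
  far-turn a f = by-multiple (- (+ 32) * a * f * f * f * u + + 12 * f * f * f * f * u + + 64 * a * a * f * u
      - + 64 * a * f * f * u + + 24 * f * f * f * u + + 16 * a * a * u - + 8 * a * f * f - + 32 * a * f * u
      + + 12 * f * f * u - + 16 * a * a + + 6 * f * f - + 4 * a + + 6 * f) A∣u² (lem u a f)
    where
    lem : ∀ u a f →
      let b = a - f - + 1 - + 4 * (u * a) * f + u * f * (f + + 1) + + 1
          g = - f - + 1 + + 4 * (u * a) - + 2 * (u * f) * (f + + 1) in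
      b - g - + 1 - + 4 * (u * b) * g + u * g * (g + + 1) - a
        ≡ (- (+ 32) * a * f * f * f * u + + 12 * f * f * f * f * u + + 64 * a * a * f * u
      - + 64 * a * f * f * u + + 24 * f * f * f * u + + 16 * a * a * u - + 8 * a * f * f - + 32 * a * f * u
      + + 12 * f * f * u - + 16 * a * a + + 6 * f * f - + 4 * a + + 6 * f) * (u * u)
    lem = solve-∀

  next-turn : ∀ a f → next (far a f + + 1) (turn a f) ≈ ρ f [ B ]
  next-turn a f = by-multiple (+ 16 * a * f - + 4 * f * f - + 4 * f) B∣u² (lem u a f)
    where
    lem : ∀ u a f →
      let b = a - f - + 1 - + 4 * (u * a) * f + u * f * (f + + 1) + + 1
          g = - f - + 1 + + 4 * (u * a) - + 2 * (u * f) * (f + + 1) in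
      g + + 1 - + 4 * (u * b) - (- f - + 2 * (u * f) * (f - + 1))
        ≡ (+ 16 * a * f - + 4 * f * f - + 4 * f) * (u * u)
    lem = solve-∀

  -- The summand 1 is there because σ₁⁻¹ takes `V₀ a` to `V₁ (a - + 1)`.
  far-turn⁻ : ∀ a f → far (far a f) (turn⁻ a f) + + 1 ≈ a [ A ]
  far-turn⁻ a f = by-multiple (- (+ 32) * a * f * f * f * u + + 12 * f * f * f * f * u + + 64 * a * a * f * u
      - + 128 * a * f * f * u + + 56 * f * f * f * u + + 16 * a * a * u - + 8 * a * f * f - + 128 * a * f * u
      + + 92 * f * f * u - + 16 * a * a + + 16 * a * f - + 32 * a * u - + 10 * f * f + + 64 * f * u
      + + 28 * a - + 22 * f + + 16 * u - + 12) A∣u² (lem u a f)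
    where
    lem : ∀ u a f →
      let b = a - f - + 1 - + 4 * (u * a) * f + u * f * (f + + 1)
          g = - f - + 1 + + 4 * (u * a) - + 2 * (u * (f + + 1)) * (f + + 2) in
      b - g - + 1 - + 4 * (u * b) * g + u * g * (g + + 1) + + 1 - a
        ≡ (- (+ 32) * a * f * f * f * u + + 12 * f * f * f * f * u + + 64 * a * a * f * u
      - + 128 * a * f * f * u + + 56 * f * f * f * u + + 16 * a * a * u - + 8 * a * f * f - + 128 * a * f * u
      + + 92 * f * f * u - + 16 * a * a + + 16 * a * f - + 32 * a * u - + 10 * f * f + + 64 * f * u
      + + 28 * a - + 22 * f + + 16 * u - + 12) * (u * u)
    lem = solve-∀

  next-turn⁻ : ∀ a f → next (far a f) (turn⁻ a f) ≈ ρ⁻ f [ B ]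
  next-turn⁻ a f = by-multiple (+ 16 * a * f - + 4 * f * f - + 4 * f) B∣u² (lem u a f)
    where
    lem : ∀ u a f →
      let b = a - f - + 1 - + 4 * (u * a) * f + u * f * (f + + 1)
          g = - f - + 1 + + 4 * (u * a) - + 2 * (u * (f + + 1)) * (f + + 2) in
      g + + 1 - + 4 * (u * b) - (- f - + 2 * (u * f) * (f + + 1))
        ≡ (+ 16 * a * f - + 4 * f * f - + 4 * f) * (u * u)
    lem = solve-∀

  -- The rotations as symmetries of the incidence structure

  onF : (ℤ → ℤ) → Fin B → Fin B
  onF p f = face (p (rep f))

  onF-face : ∀ p → (∀ {a b} → a ≈ b [ B ] → p a ≈ p b [ B ]) → ∀ f → onF p (face f) ≡ face (p f)
  onF-face p p-resp f = face-cong (p-resp (rep-residue f))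

  onF-inverse : ∀ p q → (∀ {a b} → a ≈ b [ B ] → p a ≈ p b [ B ]) → (∀ f → p (q f) ≈ f [ B ]) →
                ∀ f → onF p (onF q f) ≡ f
  onF-inverse p q p-resp pq f = trans (onF-face p p-resp (q (rep f)))
    (trans (face-cong (pq (rep f))) (residue-rep f))

  sV₁ sV₁⁻ sV₂ sV₂⁻ : Fin (A ℕ.+ A) → Fin (A ℕ.+ A)
  sV₁  = onV V₁ (λ a → V₀ (a + + 1))
  sV₁⁻ = onV (λ a → V₁ (a - + 1)) V₀
  sV₂  = onV (λ a → V₀ (a + + 2 * (u * a))) (λ a → V₁ (a - + 1 - + 2 * (u * a)))
  sV₂⁻ = onV (λ a → V₀ (a - + 2 * (u * a))) (λ a → V₁ ((+ 1 + + 2 * u) * (a + + 1)))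

  sF₁ sF₁⁻ sF₂ sF₂⁻ : Fin B → Fin B
  sF₁  = onF ρ
  sF₁⁻ = onF ρ⁻
  sF₂  = onF (λ f → f + + 1)
  sF₂⁻ = onF (λ f → f - + 1)

  -- σ₁ exchanges the roles of the two ends and of the two sides, so the new coordinates come from
  -- the images of the second end and the second side; σ₂ preserves both roles and acts on the
  -- coordinates directly.
  sE₁ sE₁⁻ sE₂ sE₂⁻ : Fin (A ℕ.* B) → Fin (A ℕ.* B)
  sE₁ e  = edge (far (coordV e) (coordF e) + + 1) (turn (coordV e) (coordF e))
  sE₁⁻ e = edge (far (coordV e) (coordF e)) (turn⁻ (coordV e) (coordF e))
  sE₂ e  = edge (coordV e + + 2 * (u * coordV e)) (coordF e + + 1)
  sE₂⁻ e = edge (coordV e - + 2 * (u * coordV e)) (coordF e - + 1)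

  V₀-resp-+1 : Respects A (λ a → V₀ (a + + 1))
  V₀-resp-+1 p = V₀-cong (+-≈ʳ (+ 1) p)

  V₁-resp--1 : Respects A (λ a → V₁ (a - + 1))
  V₁-resp--1 p = V₁-cong (+-≈ʳ (- + 1) p)

  sV₁-V₀ : ∀ a → sV₁ (V₀ a) ≡ V₁ a
  sV₁-V₀ = onV-V₀ _ _ V₁-cong

  sV₁-V₁ : ∀ a → sV₁ (V₁ a) ≡ V₀ (a + + 1)
  sV₁-V₁ = onV-V₁ _ _ V₀-resp-+1

  sV₂-V₀ : ∀ a → sV₂ (V₀ a) ≡ V₀ (a + + 2 * (u * a))
  sV₂-V₀ = onV-V₀ _ _ (λ p → V₀-cong (+-≈ p (*-≈ˡ (+ 2) (*-≈ˡ u p))))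

  sV₂-V₁ : ∀ a → sV₂ (V₁ a) ≡ V₁ (a - + 1 - + 2 * (u * a))
  sV₂-V₁ = onV-V₁ _ _ (λ p → V₁-cong (∸-≈ (+-≈ʳ (- + 1) p) (*-≈ˡ (+ 2) (*-≈ˡ u p))))

  sV₂⁻-V₀ : ∀ a → sV₂⁻ (V₀ a) ≡ V₀ (a - + 2 * (u * a))
  sV₂⁻-V₀ = onV-V₀ _ _ (λ p → V₀-cong (∸-≈ p (*-≈ˡ (+ 2) (*-≈ˡ u p))))

  sV₂⁻-V₁ : ∀ a → sV₂⁻ (V₁ a) ≡ V₁ ((+ 1 + + 2 * u) * (a + + 1))
  sV₂⁻-V₁ = onV-V₁ _ _ (λ p → V₁-cong (*-≈ˡ (+ 1 + + 2 * u) (+-≈ʳ (+ 1) p)))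

  sF₁-face : ∀ f → sF₁ (face f) ≡ face (ρ f)
  sF₁-face = onF-face ρ ρ-cong

  sF₂-face : ∀ f → sF₂ (face f) ≡ face (f + + 1)
  sF₂-face = onF-face (λ f → f + + 1) (+-≈ʳ (+ 1))

  sE₁-edge : ∀ a f → sE₁ (edge a f) ≡ edge (far a f + + 1) (turn a f)
  sE₁-edge a f = edge-cong
    (+-≈ʳ (+ 1) (far-cong (coordV-edge a f) (≈-weaken A∣B (coordF-edge a f))))
    (turn-cong (coordV-edge a f) (coordF-edge a f))

  sE₂-edge : ∀ a f → sE₂ (edge a f) ≡ edge (a + + 2 * (u * a)) (f + + 1)
  sE₂-edge a f = edge-cong
    (+-≈ (coordV-edge a f) (*-≈ˡ (+ 2) (*-≈ˡ u (coordV-edge a f)))) (+-≈ʳ (+ 1) (coordF-edge a f))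

  private
    minus-plus : ∀ a → a - + 1 + + 1 ≡ a
    minus-plus = solve-∀

    plus-minus : ∀ a → a + + 1 - + 1 ≡ a
    plus-minus = solve-∀

    shrink-grow : ∀ {n} → + n ∣ℤ u * u → ∀ a → a + + 2 * (u * a) - + 2 * (u * (a + + 2 * (u * a))) ≈ a [ n ]
    shrink-grow n∣u² a = by-multiple (- (+ 4) * a) n∣u² (lem u a)
      where
      lem : ∀ u a → a + + 2 * (u * a) - + 2 * (u * (a + + 2 * (u * a))) - a ≡ - (+ 4) * a * (u * u)
      lem = solve-∀

    grow-shrink : ∀ {n} → + n ∣ℤ u * u → ∀ a → a - + 2 * (u * a) + + 2 * (u * (a - + 2 * (u * a))) ≈ a [ n ]
    grow-shrink n∣u² a = by-multiple (- (+ 4) * a) n∣u² (lem u a)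
      where
      lem : ∀ u a → a - + 2 * (u * a) + + 2 * (u * (a - + 2 * (u * a))) - a ≡ - (+ 4) * a * (u * u)
      lem = solve-∀

  sV₁⁻-sV₁ : ∀ v → sV₁⁻ (sV₁ v) ≡ v
  sV₁⁻-sV₁ v with vertexView v
  ... | even m = onV-V₁ _ _ V₀-cong (+ m)
  ... | odd m  = trans (onV-V₀ _ _ V₁-resp--1 (+ m + + 1)) (cong V₁ (plus-minus (+ m)))

  sV₁-sV₁⁻ : ∀ v → sV₁ (sV₁⁻ v) ≡ v
  sV₁-sV₁⁻ v with vertexView v
  ... | even m = trans (sV₁-V₁ (+ m - + 1)) (cong V₀ (minus-plus (+ m)))
  ... | odd m  = sV₁-V₀ (+ m)

  sV₂⁻-sV₂ : ∀ v → sV₂⁻ (sV₂ v) ≡ v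
  sV₂⁻-sV₂ v with vertexView v
  ... | even m = trans (sV₂⁻-V₀ _) (V₀-cong (shrink-grow A∣u² (+ m)))
  ... | odd m  = trans (sV₂⁻-V₁ _) (V₁-cong (by-multiple (- (+ 4) * + m) A∣u² (lem u (+ m))))
    where
    lem : ∀ u a → (+ 1 + + 2 * u) * (a - + 1 - + 2 * (u * a) + + 1) - a ≡ - (+ 4) * a * (u * u)
    lem = solve-∀

  sV₂-sV₂⁻ : ∀ v → sV₂ (sV₂⁻ v) ≡ v
  sV₂-sV₂⁻ v with vertexView v
  ... | even m = trans (sV₂-V₀ _) (V₀-cong (grow-shrink A∣u² (+ m)))
  ... | odd m  = trans (sV₂-V₁ _) (V₁-cong (by-multiple (- (+ 4) * + m - + 4) A∣u² (lem u (+ m))))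
    where
    lem : ∀ u a → (+ 1 + + 2 * u) * (a + + 1) - + 1 - + 2 * (u * ((+ 1 + + 2 * u) * (a + + 1))) - a
      ≡ (- (+ 4) * a - + 4) * (u * u)
    lem = solve-∀

  sE₁⁻-sE₁ : ∀ e → sE₁⁻ (sE₁ e) ≡ e
  sE₁⁻-sE₁ e = trans (edge-cong
      (≈-tran (far-cong p (≈-weaken A∣B q)) (far-turn a f))
      -- `turn⁻` is traded for ρ⁻ after `next`, so that `next-turn` reduces the face coordinate to
      -- ρ⁻ (ρ f).
      (≈-tran (turn⁻-cong p q) (≈-tran (≈-symm (ρ⁻-next (far a f + + 1) (turn a f)))
        (≈-tran (ρ⁻-cong (next-turn a f)) (ρ⁻-ρ f)))))
    (edge-η e)
    where
    a = coordV e
    f = coordF e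
    p = coordV-edge (far a f + + 1) (turn a f)
    q = coordF-edge (far a f + + 1) (turn a f)

  sE₁-sE₁⁻ : ∀ e → sE₁ (sE₁⁻ e) ≡ e
  sE₁-sE₁⁻ e = trans (edge-cong
      (≈-tran (+-≈ʳ (+ 1) (far-cong p (≈-weaken A∣B q))) (far-turn⁻ a f))
      (≈-tran (turn-cong p q) (≈-tran (≈-symm (ρ-next (far a f) (turn⁻ a f)))
        (≈-tran (ρ-cong (next-turn⁻ a f)) (ρ-ρ⁻ f)))))
    (edge-η e)
    where
    a = coordV e
    f = coordF e
    p = coordV-edge (far a f) (turn⁻ a f)
    q = coordF-edge (far a f) (turn⁻ a f)

  sE₂⁻-sE₂ : ∀ e → sE₂⁻ (sE₂ e) ≡ e
  sE₂⁻-sE₂ e = trans (edge-cong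
      (≈-tran (∸-≈ p (*-≈ˡ (+ 2) (*-≈ˡ u p))) (shrink-grow A∣u² (coordV e)))
      (≈-tran (+-≈ʳ (- + 1) q) (≈-reflexive (plus-minus (coordF e)))))
    (edge-η e)
    where
    p = coordV-edge (coordV e + + 2 * (u * coordV e)) (coordF e + + 1)
    q = coordF-edge (coordV e + + 2 * (u * coordV e)) (coordF e + + 1)

  sE₂-sE₂⁻ : ∀ e → sE₂ (sE₂⁻ e) ≡ e
  sE₂-sE₂⁻ e = trans (edge-cong
      (≈-tran (+-≈ p (*-≈ˡ (+ 2) (*-≈ˡ u p))) (grow-shrink A∣u² (coordV e)))
      (≈-tran (+-≈ʳ (+ 1) q) (≈-reflexive (minus-plus (coordF e)))))
    (edge-η e)
    where
    p = coordV-edge (coordV e - + 2 * (u * coordV e)) (coordF e - + 1)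
    q = coordF-edge (coordV e - + 2 * (u * coordV e)) (coordF e - + 1)

  sym₁ : Symmetry incidence
  sym₁ = record
    { toV = sV₁ ; fromV = sV₁⁻ ; toE = sE₁ ; fromE = sE₁⁻ ; toF = sF₁ ; fromF = sF₁⁻
    ; from-toV = sV₁⁻-sV₁ ; to-fromV = sV₁-sV₁⁻ ; from-toE = sE₁⁻-sE₁ ; to-fromE = sE₁-sE₁⁻
    ; from-toF = onF-inverse ρ⁻ ρ ρ⁻-cong ρ⁻-ρ ; to-fromF = onF-inverse ρ ρ⁻ ρ-cong ρ-ρ⁻
    ; preserveVE = λ v e → trans (cong₂ (λ y z → oneOf y z (sV₁ v)) (ends₀ e) (ends₁ e))
        (trans (oneOf-swap _ _ _) (oneOf-image sV₁ sV₁⁻ sV₁⁻-sV₁ v (end₀ e) (end₁ e)))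
    ; preserveEF = λ e f → trans (cong₂ (λ y z → oneOf y z (sF₁ f)) (sides₀ e) (sides₁ e))
        (trans (oneOf-swap _ _ _) (oneOf-image sF₁ sF₁⁻ (onF-inverse ρ⁻ ρ ρ⁻-cong ρ⁻-ρ) f (side₀ e) (side₁ e)))
    ; preserveVF = λ _ _ → refl }
    where
    ends₀ : ∀ e → end₀ (sE₁ e) ≡ sV₁ (end₁ e)
    ends₀ e = trans (end₀-edge _ _) (sym (sV₁-V₁ _))
    ends₁ : ∀ e → end₁ (sE₁ e) ≡ sV₁ (end₀ e)
    ends₁ e = trans (end₁-edge _ _) (trans (V₁-cong (far-turn (coordV e) (coordF e))) (sym (sV₁-V₀ _)))
    sides₀ : ∀ e → side₀ (sE₁ e) ≡ sF₁ (side₁ e)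
    sides₀ e = trans (side₀-edge _ _)
      (trans (face-cong (≈-symm (ρ-next (coordV e) (coordF e)))) (sym (sF₁-face (next (coordV e) (coordF e)))))
    sides₁ : ∀ e → side₁ (sE₁ e) ≡ sF₁ (side₀ e)
    sides₁ e = trans (side₁-edge _ _)
      (trans (face-cong (next-turn (coordV e) (coordF e))) (sym (sF₁-face (coordF e))))

  sym₂ : Symmetry incidence
  sym₂ = record
    { toV = sV₂ ; fromV = sV₂⁻ ; toE = sE₂ ; fromE = sE₂⁻ ; toF = sF₂ ; fromF = sF₂⁻
    ; from-toV = sV₂⁻-sV₂ ; to-fromV = sV₂-sV₂⁻ ; from-toE = sE₂⁻-sE₂ ; to-fromE = sE₂-sE₂⁻
    ; from-toF = inv ; to-fromF = onF-inverse (λ f → f + + 1) (λ f → f - + 1)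
        (+-≈ʳ (+ 1)) (λ f → ≈-reflexive (minus-plus f))
    ; preserveVE = λ v e → trans (cong₂ (λ y z → oneOf y z (sV₂ v)) (ends₀ e) (ends₁ e))
        (oneOf-image sV₂ sV₂⁻ sV₂⁻-sV₂ v (end₀ e) (end₁ e))
    ; preserveEF = λ e f → trans (cong₂ (λ y z → oneOf y z (sF₂ f)) (sides₀ e) (sides₁ e))
        (oneOf-image sF₂ sF₂⁻ inv f (side₀ e) (side₁ e))
    ; preserveVF = λ _ _ → refl }
    where
    inv : ∀ f → sF₂⁻ (sF₂ f) ≡ f
    inv = onF-inverse (λ f → f - + 1) (λ f → f + + 1) (+-≈ʳ (- + 1)) (λ f → ≈-reflexive (plus-minus f))
    quot : ℤ → ℤ → ℤ
    quot a f = - (+ 16) * a * f + + 2 * f * f - + 8 * a + + 2 * f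
    lem₁ : ∀ u a f → let b = a + + 2 * (u * a)
                         g = f + + 1
                         w = a - f - + 1 - + 4 * (u * a) * f + u * f * (f + + 1) in
      b - g - + 1 - + 4 * (u * b) * g + u * g * (g + + 1) - (w - + 1 - + 2 * (u * w))
        ≡ (- (+ 16) * a * f + + 2 * f * f - + 8 * a + + 2 * f) * (u * u)
    lem₁ = solve-∀
    lem₂ : ∀ u a f → f + + 1 + + 1 - + 4 * (u * (a + + 2 * (u * a))) - (f + + 1 - + 4 * (u * a) + + 1)
        ≡ - (+ 8) * a * (u * u)
    lem₂ = solve-∀
    ends₀ : ∀ e → end₀ (sE₂ e) ≡ sV₂ (end₀ e)
    ends₀ e = trans (end₀-edge _ _) (sym (sV₂-V₀ _))
    ends₁ : ∀ e → end₁ (sE₂ e) ≡ sV₂ (end₁ e)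
    ends₁ e = trans (end₁-edge _ _) (trans (V₁-cong
      (by-multiple (quot (coordV e) (coordF e)) A∣u² (lem₁ u (coordV e) (coordF e)))) (sym (sV₂-V₁ _)))
    sides₀ : ∀ e → side₀ (sE₂ e) ≡ sF₂ (side₀ e)
    sides₀ e = trans (side₀-edge _ _) (sym (sF₂-face (coordF e)))
    sides₁ : ∀ e → side₁ (sE₂ e) ≡ sF₂ (side₁ e)
    sides₁ e = trans (side₁-edge _ _) (trans (face-cong
      (by-multiple (- (+ 8) * coordV e) B∣u² (lem₂ u (coordV e) (coordF e))))
      (sym (sF₂-face (next (coordV e) (coordF e)))))

  -- Connectivity of the structure and of its links

  open Paths incidence

  -- The boundary of the base face is the 2A-gon V₀ 0, V₁ 0, V₀ 1, V₁ 1, ...: this congruence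
  -- provides its edges from V₀ a to V₁ a, and `far-suc-0` those from V₁ a to V₀ (a + 1).
  far-0-prev : ∀ a → far a (prev a (+ 0)) ≈ a [ A ]
  far-0-prev a = by-multiple (+ 16 * a * a * u - + 16 * a * a - + 4 * a) A∣u² (lem u a)
    where
    lem : ∀ u a → let g = + 0 - + 1 + + 4 * (u * a) in
      a - g - + 1 - + 4 * (u * a) * g + u * g * (g + + 1) - a
        ≡ (+ 16 * a * a * u - + 16 * a * a - + 4 * a) * (u * u)
    lem = solve-∀

  far-suc-0 : ∀ a → far (+ 1 + a) (+ 0) ≈ a [ A ]
  far-suc-0 a = ≈-reflexive (lem u a)
    where
    lem : ∀ u a → + 1 + a - + 0 - + 1 - + 4 * (u * (+ 1 + a)) * + 0 + u * + 0 * (+ 0 + + 1) ≡ a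
    lem = solve-∀

  far-0-0 : far (+ 0) (+ 0) ≈ - + 1 [ A ]
  far-0-0 = ≈-reflexive (lem u)
    where
    lem : ∀ u → + 0 - + 0 - + 1 - + 4 * (u * + 0) * + 0 + u * + 0 * (+ 0 + + 1) ≡ - + 1
    lem = solve-∀

  next-0 : ∀ f → next (+ 0) f ≈ + 1 + f [ B ]
  next-0 f = ≈-reflexive (lem u f)
    where
    lem : ∀ u f → f + + 1 - + 4 * (u * + 0) ≡ + 1 + f
    lem = solve-∀

  vertexEl : Fin (A ℕ.+ A) → Elem incidence
  vertexEl = inj₁

  edgeEl : Fin (A ℕ.* B) → Elem incidence
  edgeEl = inj₂ ∘ inj₁

  faceEl : Fin B → Elem incidence
  faceEl = inj₂ ∘ inj₂

  v₀ : Fin (A ℕ.+ A)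
  v₀ = V₀ (+ 0)

  e₀ : Fin (A ℕ.* B)
  e₀ = edge (+ 0) (+ 0)

  f₀ : Fin B
  f₀ = face (+ 0)

  coordF-natural : ∀ e → coordF e ≈ rep (face (coordF e)) [ B ]
  coordF-natural e = ≈-symm (rep-residue (coordF e))

  link-v₀ : ConnectedOn incidence (Comparable incidence (vertexEl v₀))
  link-v₀ = connected-through (edgeEl e₀) to
    where
    walk : ∀ n → Path incidence (Comparable incidence (vertexEl v₀)) (edgeEl (edge (+ 0) (+ n))) (edgeEl e₀)
    walk zero    = here
    walk (suc n) = step {y = faceEl (face (+ suc n))} tt (face₀-on (+ 0) (+ suc n))
      (step {y = edgeEl (edge (+ 0) (+ n))} (V₀-on (+ 0) (+ n)) (face₁-on (+ 0) (+ n) (next-0 (+ n))) (walk n))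
    to : ∀ x → Comparable incidence (vertexEl v₀) x →
         Path incidence (Comparable incidence (vertexEl v₀)) x (edgeEl e₀)
    to (inj₂ (inj₁ e)) t = subst (λ d → Path incidence _ (edgeEl d) (edgeEl e₀))
      (sym (edge-by-coords e (end₀-elim e t) (coordF-natural e))) (walk _)
    to (inj₂ (inj₂ f)) t with faceView f
    ... | mkFace n = step {y = edgeEl (edge (+ 0) (+ n))} (V₀-on (+ 0) (+ n)) (face₀-on (+ 0) (+ n)) (walk n)

  link-f₀ : ConnectedOn incidence (Comparable incidence (faceEl f₀))
  link-f₀ = connected-through (vertexEl v₀) to
    where
    S = Comparable incidence (faceEl f₀)
    walk : ∀ n → Path incidence S (vertexEl (V₀ (+ n))) (vertexEl v₀)
    from-V₁ : ∀ n → Path incidence S (vertexEl (V₁ (+ n))) (vertexEl v₀)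
    walk zero    = here
    walk (suc n) = step {y = edgeEl (edge (+ suc n) (+ 0))} (face₀-on (+ suc n) (+ 0)) (V₀-on (+ suc n) (+ 0))
      (step {y = vertexEl (V₁ (+ n))} tt (V₁-on (+ suc n) (+ 0) (far-suc-0 (+ n))) (from-V₁ n))
    from-V₁ n = step {y = edgeEl (edge (+ n) (prev (+ n) (+ 0)))} (face₁-on-prev (+ n) (+ 0))
      (V₁-on (+ n) (prev (+ n) (+ 0)) (far-0-prev (+ n)))
      (step {y = vertexEl (V₀ (+ n))} tt (V₀-on (+ n) (prev (+ n) (+ 0))) (walk n))
    from-vertex : ∀ v → Path incidence S (vertexEl v) (vertexEl v₀)
    from-vertex v with vertexView v
    ... | even n = walk n
    ... | odd n  = from-V₁ n
    to : ∀ x → S x → Path incidence S x (vertexEl v₀)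
    to (inj₁ v)        t = from-vertex v
    to (inj₂ (inj₁ e)) t = step {y = vertexEl (end₀ e)} tt (oneOf-intro (inj₁ refl)) (from-vertex (end₀ e))

  -- The vertices form one orbit of σ₁, in the order V₀ 0, V₁ 0, V₀ 1, ..., so connectivity spreads
  -- from the link of `v₀`.
  link-V₀ : ∀ n → ConnectedOn incidence (Comparable incidence (vertexEl (V₀ (+ n))))
  link-V₁ : ∀ n → ConnectedOn incidence (Comparable incidence (vertexEl (V₁ (+ n))))
  link-V₀ zero    = link-v₀
  link-V₀ (suc n) = subst (λ v → ConnectedOn incidence (Comparable incidence (vertexEl v)))
    (trans (sV₁-V₁ (+ n)) (cong V₀ (ℤₚ.+-comm (+ n) (+ 1))))
    (link-transport sym₁ (vertexEl (V₁ (+ n))) (link-V₁ n))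
  link-V₁ n = subst (λ v → ConnectedOn incidence (Comparable incidence (vertexEl v))) (sV₁-V₀ (+ n))
    (link-transport sym₁ (vertexEl (V₀ (+ n))) (link-V₀ n))

  link-face : ∀ n → ConnectedOn incidence (Comparable incidence (faceEl (face (+ n))))
  link-face zero    = link-f₀
  link-face (suc n) = subst (λ f → ConnectedOn incidence (Comparable incidence (faceEl f)))
    (trans (sF₂-face (+ n)) (cong face (ℤₚ.+-comm (+ n) (+ 1))))
    (link-transport sym₂ (faceEl (face (+ n))) (link-face n))

  polyhedron : Polyhedron
  polyhedron = record
    { inc = incidence
    ; trans-VEF = λ _ _ _ _ _ → tt
    ; edge-verts = edge-verts
    ; edge-faces = edge-faces
    ; diamond = λ v f _ → diamond v f
    ; connected = connected-through (faceEl f₀) to-f₀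
    ; vertex-conn = vertex-conn
    ; face-conn = face-conn }
    where
    to-f₀ : ∀ x → _ → Path incidence _ x (faceEl f₀)
    to-f₀ (inj₁ v)        _ = step tt tt here
    to-f₀ (inj₂ (inj₁ e)) _ = step {y = vertexEl (end₀ e)} tt (oneOf-intro (inj₁ refl)) (step tt tt here)
    to-f₀ (inj₂ (inj₂ f)) _ = step {y = vertexEl v₀} tt tt (step tt tt here)
    vertex-conn : ∀ v → ConnectedOn incidence (Comparable incidence (vertexEl v))
    vertex-conn v with vertexView v
    ... | even n = link-V₀ n
    ... | odd n  = link-V₁ n
    face-conn : ∀ f → ConnectedOn incidence (Comparable incidence (faceEl f))
    face-conn f with faceView f
    ... | mkFace n = link-face n

  -- The boundary of `f₀` leads from `e₀` to the edges (a , 0), and turning around V₀ a leads from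
  -- there to all other edges at V₀ a.
  edge-induction : (Q : Fin (A ℕ.* B) → Set) →
    (∀ {e e′ v f} → T (IVE v e) → T (IEF e f) → T (IVE v e′) → T (IEF e′ f) → Q e → Q e′) →
    Q e₀ → ∀ e → Q e
  edge-induction Q move Qe₀ e with edgeView e
  ... | mkEdge m n = subst Q (edge-cong ≈-rfl (≈-tran 
        (*-≈ (rep-residue j) (≈-rfl {a = + 1 - + 4 * (u * + m)})) (unit (+ m) (+ n))))
      (around (+ m) (base m) (Fin.toℕ (face j)))
    where
    -- Each step around V₀ m adds 1 - 4um to the face coordinate; multiplying n by the inverse 1 +
    -- 4um gives the number of steps that reaches n.
    j = + n * (+ 1 + + 4 * (u * + m))
    unit : ∀ a f → f * (+ 1 + + 4 * (u * a)) * (+ 1 - + 4 * (u * a)) ≈ f [ B ]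
    unit a f = by-multiple (- (+ 16) * a * a * f) B∣u² (lem u a f)
      where
      lem : ∀ u a f → f * (+ 1 + + 4 * (u * a)) * (+ 1 - + 4 * (u * a)) - f ≡ - (+ 16) * a * a * f * (u * u)
      lem = solve-∀
    base : ∀ m → Q (edge (+ m) (+ 0))
    base zero    = Qe₀
    base (suc m) = move (V₁-on (+ m) (prev (+ m) (+ 0)) (far-0-prev (+ m))) (face₁-on-prev (+ m) (+ 0))
      (V₁-on (+ suc m) (+ 0) (far-suc-0 (+ m))) (face₀-on (+ suc m) (+ 0))
      (move (V₀-on (+ m) (+ 0)) (face₀-on (+ m) (+ 0)) (V₀-on (+ m) (prev (+ m) (+ 0)))
        (face₁-on-prev (+ m) (+ 0)) (base m))
    around : ∀ a → Q (edge a (+ 0)) → ∀ n → Q (edge a (+ n * (+ 1 - + 4 * (u * a))))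
    around a Qa zero    = Qa
    around a Qa (suc n) = move (V₀-on a f) (face₁-on a f (≈-reflexive (lem u a (+ n))))
        (V₀-on a f′) (face₀-on a f′) (around a Qa n)
      where
      f = + n * (+ 1 - + 4 * (u * a))
      f′ = + suc n * (+ 1 - + 4 * (u * a))
      lem : ∀ u a n → n * (+ 1 - + 4 * (u * a)) + + 1 - + 4 * (u * a) ≡ (+ 1 + n) * (+ 1 - + 4 * (u * a))
      lem = solve-∀

  -- Rigidity: automorphisms and the base vertex and face

  open Automorphisms polyhedron

  s₁ s₂ : Aut polyhedron
  s₁ = symmetryAut sym₁
  s₂ = symmetryAut sym₂

  -- Automorphisms carry i-adjacent flags to i-adjacent flags; the cases are i = 0, 2 and 1.
  module Images (a : Aut polyhedron) where

    other-vertex : ∀ {e v w e′ v′ w′} → T (IVE v e) → T (IVE w e) → v ≢ w →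
      T (IVE v′ e′) → T (IVE w′ e′) → v′ ≢ w′ →
      aE a e ≡ e′ → aV a v ≡ v′ → aV a w ≡ w′
    other-vertex {e} ve we v≢w ve′ we′ v′≢w′ refl refl = exactly-two-unique (edge-verts (aE a e))
      (imageVE a we) we′ ve′ (v≢w ∘ sym ∘ aV-injective a) (v′≢w′ ∘ sym)

    other-face : ∀ {e f g e′ f′ g′} → T (IEF e f) → T (IEF e g) → f ≢ g →
      T (IEF e′ f′) → T (IEF e′ g′) → f′ ≢ g′ →
      aE a e ≡ e′ → aF a f ≡ f′ → aF a g ≡ g′
    other-face {e} ef eg f≢g ef′ eg′ f′≢g′ refl refl = exactly-two-unique (edge-faces (aE a e))
      (imageEF a eg) eg′ ef′ (f≢g ∘ sym ∘ aF-injective a) (f′≢g′ ∘ sym)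

    other-edge : ∀ {v f e d v′ f′ e′ d′} →
      T (IVE v e) × T (IEF e f) → T (IVE v d) × T (IEF d f) → e ≢ d →
      T (IVE v′ e′) × T (IEF e′ f′) → T (IVE v′ d′) × T (IEF d′ f′) → e′ ≢ d′ →
      aV a v ≡ v′ → aF a f ≡ f′ → aE a e ≡ e′ → aE a d ≡ d′
    other-edge {v} {f} _ (vd , df) e≢d ve′ vd′ e′≢d′ refl refl refl =
      exactly-two-unique (diamond (aV a v) (aF a f))
        (imageVE a vd , imageEF a df) vd′ ve′ (e≢d ∘ sym ∘ aE-injective a) (e′≢d′ ∘ sym)

  -- For the base flag Φ these are the edges of Φ¹ and of (Φ²)¹.
  e₁ e₂ : Fin (A ℕ.* B)
  e₁ = edge (+ 0) (prev (+ 0) (+ 0))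
  e₂ = edge (+ 0) (+ 1)

  e₀≢e₁ : e₀ ≢ e₁
  e₀≢e₁ = side-roles-differ (≈-reflexive (next-prev (+ 0) (+ 0)))

  e₀≢e₂ : e₀ ≢ e₂
  e₀≢e₂ = side-roles-differ (next-0 (+ 0)) ∘ sym

  e₀≢e₁-at : ∀ c → aE c e₁ ≢ aE c e₀
  e₀≢e₁-at c eq = e₀≢e₁ (sym (aE-injective c eq))

  s₁-e₀ : aE s₁ e₀ ≡ e₁
  s₁-e₀ = trans (sE₁-edge (+ 0) (+ 0)) (edge-cong (≈-reflexive (lem₁ u)) (≈-reflexive (lem₂ u)))
    where
    lem₁ : ∀ u → + 0 - + 0 - + 1 - + 4 * (u * + 0) * + 0 + u * + 0 * (+ 0 + + 1) + + 1 ≡ + 0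
    lem₁ = solve-∀
    lem₂ : ∀ u → - + 0 - + 1 + + 4 * (u * + 0) - + 2 * (u * + 0) * (+ 0 + + 1) ≡ + 0 - + 1 + + 4 * (u * + 0)
    lem₂ = solve-∀

  s₂-e₀ : aE s₂ e₀ ≡ e₂
  s₂-e₀ = trans (sE₂-edge (+ 0) (+ 0)) (edge-cong (≈-reflexive (lem u)) ≈-rfl)
    where
    lem : ∀ u → + 0 + + 2 * (u * + 0) ≡ + 0
    lem = solve-∀

  s₂-e₁ : aE s₂ e₁ ≡ e₀
  s₂-e₁ = trans (sE₂-edge (+ 0) _) (edge-cong (≈-reflexive (lem₁ u)) (≈-reflexive (lem₂ u)))
    where
    lem₁ : ∀ u → + 0 + + 2 * (u * + 0) ≡ + 0
    lem₁ = solve-∀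
    lem₂ : ∀ u → + 0 - + 1 + + 4 * (u * + 0) + + 1 ≡ + 0
    lem₂ = solve-∀

  v₀∈e₀ : T (IVE v₀ e₀)
  v₀∈e₀ = V₀-on (+ 0) (+ 0)

  v₀∈e₁ : T (IVE v₀ e₁)
  v₀∈e₁ = V₀-on (+ 0) (prev (+ 0) (+ 0))

  v₀∈e₂ : T (IVE v₀ e₂)
  v₀∈e₂ = V₀-on (+ 0) (+ 1)

  V₁0∈e₁ : T (IVE (V₁ (+ 0)) e₁)
  V₁0∈e₁ = V₁-on (+ 0) (prev (+ 0) (+ 0)) (far-0-prev (+ 0))

  V₁-1∈e₀ : T (IVE (V₁ (- + 1)) e₀)
  V₁-1∈e₀ = V₁-on (+ 0) (+ 0) far-0-0

  e₀∈f₀ : T (IEF e₀ f₀)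
  e₀∈f₀ = face₀-on (+ 0) (+ 0)

  e₁∈f₀ : T (IEF e₁ f₀)
  e₁∈f₀ = face₁-on-prev (+ 0) (+ 0)

  f₁ f₋₁ : Fin B
  f₁ = face (+ 1)
  f₋₁ = face (prev (+ 0) (+ 0))

  e₀∈f₁ : T (IEF e₀ f₁)
  e₀∈f₁ = face₁-on (+ 0) (+ 0) (next-0 (+ 0))

  e₂∈f₁ : T (IEF e₂ f₁)
  e₂∈f₁ = face₀-on (+ 0) (+ 1)

  e₁∈f₋₁ : T (IEF e₁ f₋₁)
  e₁∈f₋₁ = face₀-on (+ 0) (prev (+ 0) (+ 0))

  f₀≢f₁ : f₀ ≢ f₁
  f₀≢f₁ eq = next-moves (+ 0) (+ 0) (≈-tran (residue-injective eq) (≈-symm (next-0 (+ 0))))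

  f₋₁≢f₀ : f₋₁ ≢ f₀
  f₋₁≢f₀ eq = next-moves (+ 0) (prev (+ 0) (+ 0))
    (≈-tran (residue-injective eq) (≈-reflexive (sym (next-prev (+ 0) (+ 0)))))

  module Mirror (a : Aut polyhedron) (fix-v : aV a v₀ ≡ v₀) (fix-f : aF a f₀ ≡ f₀) where
    open Images a

    back : ℤ → ℤ
    back f = - f - + 1

    next-back : ∀ f → next (+ 0) (back f) ≈ - f [ B ]
    next-back f = ≈-reflexive (lem u f)
      where
      lem : ∀ u f → - f - + 1 + + 1 - + 4 * (u * + 0) ≡ - f
      lem = solve-∀

    back≈ : ∀ f → back f ≈ - (+ 1 + f) [ B ]
    back≈ f = ≈-reflexive (lem f)
      where
      lem : ∀ f → - f - + 1 ≡ - (+ 1 + f)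
      lem = solve-∀

    sides-differ : ∀ a f {x} → next a f ≈ x [ B ] → face f ≢ face x
    sides-differ a f p eq = next-moves a f (≈-tran (residue-injective eq) (≈-symm p))

    module _ (moved : aE a e₀ ≢ e₀) where

      e₀↦e₁ : aE a e₀ ≡ e₁
      e₀↦e₁ = exactly-two-unique (diamond v₀ f₀)
        (subst (λ v → T (IVE v (aE a e₀))) fix-v (imageVE a v₀∈e₀) ,
         subst (T ∘ IEF (aE a e₀)) fix-f (imageEF a e₀∈f₀))
        (v₀∈e₁ , e₁∈f₀) (v₀∈e₀ , e₀∈f₀) moved (e₀≢e₁ ∘ sym)

      e₁↦e₀ : aE a e₁ ≡ e₀
      e₁↦e₀ = other-edge (v₀∈e₀ , e₀∈f₀) (v₀∈e₁ , e₁∈f₀) e₀≢e₁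
        (v₀∈e₁ , e₁∈f₀) (v₀∈e₀ , e₀∈f₀) (e₀≢e₁ ∘ sym) fix-v fix-f e₀↦e₁

      -- The edge (0 , n) has first side n and second side n + 1. Their images -n and -(n + 1) occur
      -- in the opposite order, so the image edge has face coordinate -n - 1.
      around-v₀ : ∀ n → aE a (edge (+ 0) (+ n)) ≡ edge (+ 0) (back (+ n)) × aF a (face (+ n)) ≡ face (- + n)
      around-v₀ zero    = trans e₀↦e₁ (edge-cong ≈-rfl (≈-reflexive (lem u))) , fix-f
        where
        lem : ∀ u → + 0 - + 1 + + 4 * (u * + 0) ≡ - + 0 - + 1
        lem = solve-∀
      around-v₀ (suc n) = edge↦ , face↦
        where
        ih = around-v₀ n
        f = + n
        g = + suc n
        f-on : T (IEF (edge (+ 0) (back f)) (face (- f)))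
        f-on = face₁-on (+ 0) (back f) (next-back f)
        g-on : T (IEF (edge (+ 0) (back f)) (face (- g)))
        g-on = subst (T ∘ IEF (edge (+ 0) (back f))) (face-cong (back≈ f)) (face₀-on (+ 0) (back f))
        face↦ : aF a (face g) ≡ face (- g)
        face↦ = other-face (face₀-on (+ 0) f) (face₁-on (+ 0) f (next-0 f)) (sides-differ (+ 0) f (next-0 f))
          f-on g-on (λ eq → sides-differ (+ 0) (back f) (next-back f) (trans (face-cong (back≈ f)) (sym eq)))
          (proj₁ ih) (proj₂ ih)
        edge↦ : aE a (edge (+ 0) g) ≡ edge (+ 0) (back g)
        edge↦ = other-edge
          (V₀-on (+ 0) f , face₁-on (+ 0) f (next-0 f)) (V₀-on (+ 0) g , face₀-on (+ 0) g)
          (side-roles-differ (next-0 f) ∘ sym)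
          (V₀-on (+ 0) (back f) , g-on) (V₀-on (+ 0) (back g) , face₁-on (+ 0) (back g) (next-back g))
          (λ eq → side-roles-differ (≈-tran (next-back g) (≈-symm (back≈ f))) eq)
          fix-v face↦ (proj₁ ih)

      V₁0↦ : aV a (V₁ (+ 0)) ≡ V₁ (- + 1)
      V₁0↦ = other-vertex v₀∈e₁ V₁0∈e₁ V₀≢V₁
        v₀∈e₀ V₁-1∈e₀ V₀≢V₁ e₁↦e₀ fix-v

      -- On the boundary of `f₀` this edge follows `e₀` beyond V₁ (-1), just as the edge (1 , 0)
      -- follows `e₁` beyond V₁ 0.
      far-edge : Fin (A ℕ.* B)
      far-edge = edge (- + 1) (prev (- + 1) (+ 0))

      edge10↦ : aE a (edge (+ 1) (+ 0)) ≡ far-edge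
      edge10↦ = other-edge
        (V₁0∈e₁ , e₁∈f₀)
        (V₁-on (+ 1) (+ 0) (far-suc-0 (+ 0)) , face₀-on (+ 1) (+ 0))
        (side-roles-differ (≈-reflexive (next-prev (+ 0) (+ 0))) ∘ sym)
        (V₁-1∈e₀ , e₀∈f₀)
        (V₁-on (- + 1) (prev (- + 1) (+ 0)) (far-0-prev (- + 1)) , face₁-on-prev (- + 1) (+ 0))
        (side-roles-differ (≈-reflexive (next-prev (- + 1) (+ 0))))
        V₁0↦ fix-f e₁↦e₀

      face↦ : aF a (face (next (+ 1) (+ 0))) ≡ face (prev (- + 1) (+ 0))
      face↦ = other-face (face₀-on (+ 1) (+ 0)) (face₁-on (+ 1) (+ 0) ≈-rfl) (sides-differ (+ 1) (+ 0) ≈-rfl)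
        (face₁-on-prev (- + 1) (+ 0)) (face₀-on (- + 1) (prev (- + 1) (+ 0)))
        (sides-differ (- + 1) (prev (- + 1) (+ 0)) (≈-reflexive (next-prev (- + 1) (+ 0))) ∘ sym)
        edge10↦ fix-f

      face-negated : ∀ f → aF a (face f) ≡ face (- f)
      face-negated f = trans (cong (aF a) (face-cong (≈-symm (rep-residue f))))
        (trans (proj₂ (around-v₀ (Fin.toℕ (face f)))) (face-cong (neg-≈ (rep-residue f))))

      impossible : ⊥
      impossible = B∤8u (subst (+ B ∣ℤ_) (lem u) (divisible
        (residue-injective (trans (sym (face-negated (next (+ 1) (+ 0)))) face↦))))
        where
        lem : ∀ u → - (+ 0 + + 1 - + 4 * (u * + 1)) - (+ 0 - + 1 + + 4 * (u * (- + 1))) ≡ + 8 * u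
        lem = solve-∀

    no-mirror : aE a e₀ ≡ e₀
    no-mirror with aE a e₀ Fin.≟ e₀
    ... | yes eq   = eq
    ... | no moved = ⊥-elim (impossible moved)

  open Mirror using (no-mirror)

  -- The automorphism b⁻¹a fixes `v₀` and `f₀`, hence also `e₀`.
  edge-agrees : ∀ (a b : Aut polyhedron) → aV a v₀ ≡ aV b v₀ → aF a f₀ ≡ aF b f₀ → aE a e₀ ≡ aE b e₀
  edge-agrees a b eqV eqF = trans (sym (abE b (aE a e₀))) (cong (aE b)
    (no-mirror (_∘A_ polyhedron (invAut polyhedron b) a)
      (trans (cong (bV b) eqV) (baV b v₀)) (trans (cong (bF b) eqF) (baF b f₀))))

  faithful : ∀ (a b : Aut polyhedron) → aV a v₀ ≡ aV b v₀ → aF a f₀ ≡ aF b f₀ → AutEq polyhedron a b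
  faithful a b eqV eqF = agree-everywhere a b edgeAtV edgeAtF
    (edge-induction (AgreeAt a b) (agree-step a b)
      (agree-at-flag a b (V₀-on (+ 0) (+ 0)) (face₀-on (+ 0) (+ 0)) eqV (edge-agrees a b eqV eqF) eqF))
    where
    edgeAtV : ∀ v → Σ[ e ∈ Fin (A ℕ.* B) ] T (IVE v e)
    edgeAtV v = let (e , _ , _ , (ve , _) , _) = diamond v f₀ in e , ve
    edgeAtF : ∀ f → Σ[ e ∈ Fin (A ℕ.* B) ] T (IEF e f)
    edgeAtF f = let (e , _ , _ , (_ , ef) , _) = diamond v₀ f in e , ef

  -- The action of words on vertices and faces

  evalP : Word → Aut polyhedron
  evalP = eval polyhedron s₁ s₂

  evalLP : Letter → Aut polyhedron
  evalLP = evalL polyhedron s₁ s₂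

  private
    rotation : Gen → Aut polyhedron
    rotation = evalGen polyhedron s₁ s₂

    aV-inverse : ∀ l v → aV (evalLP l) (aV (evalLP (invL l)) v) ≡ v
    aV-inverse (g , true)  = abV (rotation g)
    aV-inverse (g , false) = baV (rotation g)

    aF-inverse : ∀ l f → aF (evalLP l) (aF (evalLP (invL l)) f) ≡ f
    aF-inverse (g , true)  = abF (rotation g)
    aF-inverse (g , false) = baF (rotation g)

  module VertexAction = Action (λ l → aV (evalLP l)) aV-inverse
  module FaceAction = Action (λ l → aF (evalLP l)) aF-inverse

  aV-eval : ∀ w v → aV (evalP w) v ≡ VertexAction.run w v
  aV-eval []      v = refl
  aV-eval (l ∷ w) v = cong (aV (evalLP l)) (aV-eval w v)

  aF-eval : ∀ w f → aF (evalP w) f ≡ FaceAction.run w f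
  aF-eval []      f = refl
  aF-eval (l ∷ w) f = cong (aF (evalLP l)) (aF-eval w f)

  σ₁-even-V : ∀ n → VertexAction.run (pow σ₁ (+ 2 * n)) v₀ ≡ V₀ n
  σ₁-even-V = VertexAction.run-orbit-even σ₁ V₀ V₁ sV₁-V₀ (λ n → trans (sV₁-V₁ n) (cong V₀ (ℤₚ.+-comm n (+ 1))))

  σ₁-odd-V : ∀ n → VertexAction.run (pow σ₁ (+ 1 + + 2 * n)) v₀ ≡ V₁ n
  σ₁-odd-V = VertexAction.run-orbit-odd σ₁ V₀ V₁ sV₁-V₀ (λ n → trans (sV₁-V₁ n) (cong V₀ (ℤₚ.+-comm n (+ 1))))

  σ₂-v₀ : sV₂ v₀ ≡ v₀
  σ₂-v₀ = trans (sV₂-V₀ (+ 0)) (V₀-cong (≈-reflexive (lem u)))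
    where
    lem : ∀ u → + 0 + + 2 * (u * + 0) ≡ + 0
    lem = solve-∀

  σ₂-V : ∀ n → VertexAction.run (pow σ₂ n) v₀ ≡ v₀
  σ₂-V = VertexAction.run-orbit σ₂ (λ _ → v₀) (λ _ → σ₂-v₀)

  σ₂-F : ∀ n → FaceAction.run (pow σ₂ n) f₀ ≡ face n
  σ₂-F = FaceAction.run-orbit σ₂ face (λ n → trans (sF₂-face n) (cong face (ℤₚ.+-comm n (+ 1))))

  -- σ₁² multiplies the face coordinate by 1 − 4u.
  module _ (x : ℤ) where
    -- This is (1 - 4u)^n x reduced modulo u², in a form that also makes sense for negative n.
    rotate : ℤ → ℤ
    rotate n = (+ 1 - + 4 * (u * n)) * x

    rotate-0 : rotate (+ 0) ≈ x [ B ]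
    rotate-0 = ≈-reflexive (lem u x)
      where
      lem : ∀ u x → (+ 1 - + 4 * (u * + 0)) * x ≡ x
      lem = solve-∀

    ρ-ρ-rotate : ∀ n → sF₁ (face (ρ (rotate n))) ≡ face (rotate (+ 1 + n))
    ρ-ρ-rotate n = trans (sF₁-face _) (face-cong (≈-tran (ρρ (rotate n))
      (by-multiple (+ 16 * n * x) B∣u² (lem u n x))))
      where
      ρρ : ∀ f → ρ (ρ f) ≈ (+ 1 - + 4 * u) * f [ B ]
      ρρ f = by-multiple (- (+ 8) * f * f * f * f * u + + 16 * f * f * f * u - + 8 * f * f * f
          - + 8 * f * f * u + + 4 * f * f + + 4 * f) B∣u² (lem′ u f)
        where
        lem′ : ∀ u f → let g = - f - + 2 * (u * f) * (f - + 1) in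
          - g - + 2 * (u * g) * (g - + 1) - (+ 1 - + 4 * u) * f
            ≡ (- (+ 8) * f * f * f * f * u + + 16 * f * f * f * u - + 8 * f * f * f
          - + 8 * f * f * u + + 4 * f * f + + 4 * f) * (u * u)
        lem′ = solve-∀
      lem : ∀ u n x → (+ 1 - + 4 * u) * ((+ 1 - + 4 * (u * n)) * x) - (+ 1 - + 4 * (u * (+ 1 + n))) * x
          ≡ + 16 * n * x * (u * u)
      lem = solve-∀

    σ₁-even-F : ∀ n → FaceAction.run (pow σ₁ (+ 2 * n)) (face x) ≡ face (rotate n)
    σ₁-even-F n = trans (cong (FaceAction.run (pow σ₁ (+ 2 * n))) (sym (face-cong rotate-0)))
      (FaceAction.run-orbit-even σ₁ (face ∘ rotate) (face ∘ ρ ∘ rotate) (λ k → sF₁-face (rotate k)) ρ-ρ-rotate n)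

    σ₁-odd-F : ∀ n → FaceAction.run (pow σ₁ (+ 1 + + 2 * n)) (face x) ≡ face (ρ (rotate n))
    σ₁-odd-F n = trans (cong (FaceAction.run (pow σ₁ (+ 1 + + 2 * n))) (sym (face-cong rotate-0)))
      (FaceAction.run-orbit-odd σ₁ (face ∘ rotate) (face ∘ ρ ∘ rotate) (λ k → sF₁-face (rotate k)) ρ-ρ-rotate n)

  σ₁-f₀ : sF₁ f₀ ≡ f₀
  σ₁-f₀ = trans (sF₁-face (+ 0)) (face-cong (≈-reflexive (lem u)))
    where
    lem : ∀ u → - + 0 - + 2 * (u * + 0) * (+ 0 - + 1) ≡ + 0
    lem = solve-∀

  σ₁-F : ∀ n → FaceAction.run (pow σ₁ n) f₀ ≡ f₀
  σ₁-F = FaceAction.run-orbit σ₁ (λ _ → f₀) (λ _ → σ₁-f₀)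

  eval-≡ : ∀ l r → VertexAction.run l v₀ ≡ VertexAction.run r v₀ → FaceAction.run l f₀ ≡ FaceAction.run r f₀ →
           AutEq polyhedron (evalP l) (evalP r)
  eval-≡ l r eqV eqF = faithful (evalP l) (evalP r)
    (trans (aV-eval l v₀) (trans eqV (sym (aV-eval r v₀))))
    (trans (aF-eval l f₀) (trans eqF (sym (aF-eval r f₀))))

  -- The base flag and the distinguished generators

  base : Flag polyhedron
  base = flag v₀ e₀ f₀ v₀∈e₀ e₀∈f₀

  base¹ : Flag polyhedron
  base¹ = flag v₀ e₁ f₀ v₀∈e₁ e₁∈f₀

  isSigma₁ : IsSigma1 polyhedron base s₁
  isSigma₁ = base¹ , flag (V₁ (+ 0)) e₁ f₀ V₁0∈e₁ e₁∈f₀ ,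
    (refl , e₀≢e₁ , refl) , (V₀≢V₁ , refl , refl) , (sV₁-V₀ (+ 0) , s₁-e₀ , σ₁-f₀)

  isSigma₂ : IsSigma2 polyhedron base s₂
  isSigma₂ = flag v₀ e₀ f₁ v₀∈e₀ e₀∈f₁ , flag v₀ e₂ f₁ v₀∈e₂ e₂∈f₁ ,
    (refl , refl , f₀≢f₁) , (refl , e₀≢e₂ , refl) , (σ₂-v₀ , s₂-e₀ , sF₂-face (+ 0))

  -- If c fixed e₀ (or e₁) and exactly one of v₀ and f₀, then s₁ c, s₁⁻¹ c, s₂ c or s₂⁻¹ c
  -- would fix v₀ and f₀ but not e₀.
  module Reversal (c : Aut polyhedron) where
    infixr 9 _∙_
    _∙_ = _∘A_ polyhedron
    inv = invAut polyhedron

    vertex-e₀ : aE c e₀ ≡ e₀ → aF c f₀ ≡ f₀ → aV c v₀ ≡ v₀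
    vertex-e₀ fixE fixF with aV c v₀ Fin.≟ v₀
    ... | yes eq = eq
    ... | no ne  = ⊥-elim (e₀≢e₁ (sym (trans (sym s₁-e₀) (trans (cong (aE s₁) (sym fixE))
      (Mirror.no-mirror (s₁ ∙ c)
        (trans (cong sV₁ v₀↦) (trans (sV₁-V₁ (- + 1)) (V₀-cong ≈-rfl)))
        (trans (cong sF₁ fixF) σ₁-f₀))))))
      where
      v₀↦ : aV c v₀ ≡ V₁ (- + 1)
      v₀↦ = exactly-two-unique (edge-verts e₀) (subst (T ∘ IVE _) fixE (imageVE c v₀∈e₀))
        V₁-1∈e₀ v₀∈e₀ ne (V₀≢V₁ ∘ sym)

    vertex-e₁ : aE c e₁ ≡ e₁ → aF c f₀ ≡ f₀ → aV c v₀ ≡ v₀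
    vertex-e₁ fixE fixF with aV c v₀ Fin.≟ v₀
    ... | yes eq = eq
    ... | no ne  = ⊥-elim (e₀≢e₁-at (inv s₁ ∙ c) (trans
        (trans (cong (bE s₁) (trans fixE (sym s₁-e₀))) (baE s₁ e₀))
        (sym (Mirror.no-mirror (inv s₁ ∙ c)
          (trans (cong (bV s₁) (trans v₀↦ (sym (sV₁-V₀ (+ 0))))) (baV s₁ v₀))
          (trans (cong (bF s₁) (trans fixF (sym σ₁-f₀))) (baF s₁ f₀))))))
      where
      v₀↦ : aV c v₀ ≡ V₁ (+ 0)
      v₀↦ = exactly-two-unique (edge-verts e₁) (subst (T ∘ IVE _) fixE (imageVE c v₀∈e₁))
        V₁0∈e₁ v₀∈e₁ ne (V₀≢V₁ ∘ sym)

    face-e₀ : aE c e₀ ≡ e₀ → aV c v₀ ≡ v₀ → aF c f₀ ≡ f₀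
    face-e₀ fixE fixV with aF c f₀ Fin.≟ f₀
    ... | yes eq = eq
    ... | no ne  = ⊥-elim (e₀≢e₂ (trans (sym fixE) (trans (sym (abE s₂ (aE c e₀)))
        (trans (cong (aE s₂) (Mirror.no-mirror (inv s₂ ∙ c)
          (trans (cong (bV s₂) (trans fixV (sym σ₂-v₀))) (baV s₂ v₀))
          (trans (cong (bF s₂) (trans f₀↦ (sym (sF₂-face (+ 0))))) (baF s₂ f₀)))) s₂-e₀))))
      where
      f₀↦ : aF c f₀ ≡ f₁
      f₀↦ = exactly-two-unique (edge-faces e₀) (subst (λ e → T (IEF e _)) fixE (imageEF c e₀∈f₀))
        e₀∈f₁ e₀∈f₀ ne (f₀≢f₁ ∘ sym)

    face-e₁ : aE c e₁ ≡ e₁ → aV c v₀ ≡ v₀ → aF c f₀ ≡ f₀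
    face-e₁ fixE fixV with aF c f₀ Fin.≟ f₀
    ... | yes eq = eq
    ... | no ne  = ⊥-elim (e₀≢e₁-at (s₂ ∙ c) (trans (trans (cong (aE s₂) fixE) s₂-e₁)
        (sym (Mirror.no-mirror (s₂ ∙ c) (trans (cong sV₂ fixV) σ₂-v₀)
          (trans (cong sF₂ f₀↦) (trans (sF₂-face _) (face-cong (≈-reflexive (lem u)))))))))
      where
      lem : ∀ u → + 0 - + 1 + + 4 * (u * + 0) + + 1 ≡ + 0
      lem = solve-∀
      f₀↦ : aF c f₀ ≡ f₋₁
      f₀↦ = exactly-two-unique (edge-faces e₁) (subst (λ e → T (IEF e _)) fixE (imageEF c e₁∈f₀))
        e₁∈f₋₁ e₁∈f₀ ne f₋₁≢f₀

  -- Soundness and completeness of the relations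

  module Relators (M t C : ℕ) (B∣uM : + B ∣ℤ u * + M)
    (H≈2u : + (M ℕ.* t) ≈ + 2 * u [ A ]) (C≈4u : + C ≈ + 4 * u [ B ]) where

    E : ℕ
    E = 2 ℕ.* M ℕ.* t

    H : ℕ
    H = M ℕ.* t

    R : Relations
    R = presentation (2 ℕ.* A) B M E C

    E≡2H : + E ≡ + 2 * + H
    E≡2H = trans (cong +_ (ℕₚ.*-assoc 2 M t)) (ℤₚ.pos-* 2 H)

    uH≈0 : u * + H ≈ + 0 [ B ]
    uH≈0 = ≈-tran (u-scale H≈2u) (by-multiple (+ 2) B∣u² (lem u))
      where
      lem : ∀ u → u * (+ 2 * u) - + 0 ≡ + 2 * (u * u)
      lem = solve-∀

    -- σ₁^E is τ^H and fixes every face, since u·H ≡ 2u² vanishes; only the remaining exponent n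
    -- acts.
    rotate≈ : ∀ n y → rotate (+ C + y) (+ H + n) ≈ (+ 1 - + 4 * (u * n)) * (+ 4 * u + y) [ B ]
    rotate≈ n y = *-≈ (∸-≈ (≈-rfl {a = + 1}) (*-≈ˡ (+ 4)
        (≈-tran (≈-reflexive (ℤₚ.*-distribˡ-+ u (+ H) n))
          (≈-tran (+-≈ʳ (u * n) uH≈0) (≈-reflexive (ℤₚ.+-identityˡ (u * n)))))))
      (+-≈ʳ y C≈4u)

    relation-holds : ∀ l r → (l , r) ∈ R → AutEq polyhedron (evalP l) (evalP r)
    relation-holds l r (here refl) = eval-≡ l r
      (trans (cong (λ n → VertexAction.run (pow σ₁ n) v₀) (ℤₚ.pos-* 2 A))
        (trans (σ₁-even-V (+ A)) (V₀-cong (mod (ℤ∣.divides (+ 1) (lem (+ A)))))))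
      (σ₁-F (+ (2 ℕ.* A)))
      where
      lem : ∀ a → a - + 0 ≡ + 1 * a
      lem = solve-∀
    relation-holds l r (there (here refl)) = eval-≡ l r (σ₂-V (+ B))
      (trans (σ₂-F (+ B)) (face-cong (mod (ℤ∣.divides (+ 1) (lem (+ B))))))
      where
      lem : ∀ a → a - + 0 ≡ + 1 * a
      lem = solve-∀
    relation-holds l r (there (there (here refl))) = eval-≡ l r
      (trans (cong (sV₁ ∘ sV₂) (trans (cong sV₁ σ₂-v₀) (sV₁-V₀ (+ 0))))
        (trans (cong sV₁ (sV₂-V₁ (+ 0))) (trans (sV₁-V₁ _) (V₀-cong (≈-reflexive (lem₁ u))))))
      (trans (cong (sF₁ ∘ sF₂) (trans (cong sF₁ (sF₂-face (+ 0))) (sF₁-face _)))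
        (trans (cong sF₁ (trans (sF₂-face _) (face-cong (≈-reflexive (lem₂ u))))) σ₁-f₀))
      where
      lem₁ : ∀ u → + 0 - + 1 - + 2 * (u * + 0) + + 1 ≡ + 0
      lem₁ = solve-∀
      lem₂ : ∀ u → - (+ 0 + + 1) - + 2 * (u * (+ 0 + + 1)) * (+ 0 + + 1 - + 1) + + 1 ≡ + 0
      lem₂ = solve-∀
    -- Both sides take `v₀` to V₁ (2u + 1) and `f₀` to the face -1.
    relation-holds l r (there (there (there (here refl)))) = eval-≡ l r
      (trans (cong sV₂⁻ (sV₁-V₀ (+ 0))) (trans (sV₂⁻-V₁ (+ 0))
        (trans (V₁-cong (≈-tran (≈-reflexive (lem₁ u)) (≈-symm (+-≈ʳ (+ 1) H≈2u))))
          (sym (trans (VertexAction.run-++ (pow σ₁ (+ 3 + + E)) _ v₀)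
            (trans (cong (VertexAction.run (pow σ₁ (+ 3 + + E))) (σ₂-V (+ 1 + + C)))
              (trans (cong (λ n → VertexAction.run (pow σ₁ n) v₀) exponent) (σ₁-odd-V (+ H + + 1)))))))))
      (trans (cong sF₂⁻ σ₁-f₀) (trans (onF-face (λ f → f - + 1) (+-≈ʳ (- + 1)) (+ 0))
        (sym (trans (FaceAction.run-++ (pow σ₁ (+ 3 + + E)) _ f₀)
          (trans (cong (FaceAction.run (pow σ₁ (+ 3 + + E)))
              (trans (σ₂-F (+ 1 + + C)) (cong face (ℤₚ.+-comm (+ 1) (+ C)))))
            (trans (cong (λ n → FaceAction.run (pow σ₁ n) (face (+ C + + 1))) exponent)
              (trans (σ₁-odd-F (+ C + + 1) (+ H + + 1)) (face-cong
                (≈-tran (ρ-cong (≈-tran (rotate≈ (+ 1) (+ 1))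
                  (by-multiple (- (+ 16)) B∣u² (lem₂ u)))) (≈-reflexive (lem₃ u)))))))))))
      where
      exponent : + 3 + + E ≡ + 1 + + 2 * (+ H + + 1)
      exponent = trans (cong (λ n → + 3 + n) E≡2H) (lem (+ H))
        where
        lem : ∀ h → + 3 + + 2 * h ≡ + 1 + + 2 * (h + + 1)
        lem = solve-∀
      lem₁ : ∀ u → (+ 1 + + 2 * u) * (+ 0 + + 1) ≡ + 2 * u + + 1
      lem₁ = solve-∀
      lem₂ : ∀ u → (+ 1 - + 4 * (u * + 1)) * (+ 4 * u + + 1) - + 1 ≡ - (+ 16) * (u * u)
      lem₂ = solve-∀
      lem₃ : ∀ u → - + 1 - + 2 * (u * + 1) * (+ 1 - + 1) ≡ + 0 - + 1
      lem₃ = solve-∀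
    -- Both sides take `v₀` to V₁ (2u - 2) and `f₀` to the face 1.
    relation-holds l r (there (there (there (there (here refl))))) = eval-≡ l r
      (trans (cong sV₂ (onV-V₀ _ _ V₁-resp--1 (+ 0))) (trans (sV₂-V₁ _)
        (trans (V₁-cong (≈-tran (≈-reflexive (lem₁ u)) (≈-symm (+-≈ʳ (- + 2) H≈2u))))
          (sym (trans (VertexAction.run-++ (pow σ₁ (- + 3 + + E)) _ v₀)
            (trans (cong (VertexAction.run (pow σ₁ (- + 3 + + E))) (σ₂-V (- + 1 + + C)))
              (trans (cong (λ n → VertexAction.run (pow σ₁ n) v₀) exponent) (σ₁-odd-V (+ H + - + 2)))))))))
      (trans (cong sF₂ (onF-face ρ⁻ ρ⁻-cong (+ 0))) (trans (sF₂-face (ρ⁻ (+ 0)))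
        (trans (face-cong (≈-reflexive (lem₄ u)))
        (sym (trans (FaceAction.run-++ (pow σ₁ (- + 3 + + E)) _ f₀)
          (trans (cong (FaceAction.run (pow σ₁ (- + 3 + + E)))
              (trans (σ₂-F (- + 1 + + C)) (cong face (ℤₚ.+-comm (- + 1) (+ C)))))
            (trans (cong (λ n → FaceAction.run (pow σ₁ n) (face (+ C + - + 1))) exponent)
              (trans (σ₁-odd-F (+ C + - + 1) (+ H + - + 2)) (face-cong
                (≈-tran (ρ-cong (≈-tran (rotate≈ (- + 2) (- + 1))
                  (by-multiple (+ 32) B∣u² (lem₂ u)))) (by-multiple (- (+ 24) - + 32 * u) B∣u² (lem₃ u))))))))))))
      where
      exponent : - + 3 + + E ≡ + 1 + + 2 * (+ H + - + 2)
      exponent = trans (cong (λ n → - + 3 + n) E≡2H) (lem (+ H))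
        where
        lem : ∀ h → - + 3 + + 2 * h ≡ + 1 + + 2 * (h + - + 2)
        lem = solve-∀
      lem₁ : ∀ u → + 0 - + 1 - + 1 - + 2 * (u * (+ 0 - + 1)) ≡ + 2 * u + - + 2
      lem₁ = solve-∀
      lem₂ : ∀ u → (+ 1 - + 4 * (u * - + 2)) * (+ 4 * u + - + 1) - (- + 1 - + 4 * u) ≡ + 32 * (u * u)
      lem₂ = solve-∀
      lem₃ : ∀ u → let g = - + 1 - + 4 * u in
        - g - + 2 * (u * g) * (g - + 1) - + 1 ≡ (- (+ 24) - + 32 * u) * (u * u)
      lem₃ = solve-∀
      lem₄ : ∀ u → - + 0 - + 2 * (u * + 0) * (+ 0 + + 1) + + 1 ≡ + 1
      lem₄ = solve-∀
    -- Since u·M vanishes, σ₂ fixes V₀ M and σ₁^(2M) fixes the face 1.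
    relation-holds l r (there (there (there (there (there (here refl)))))) = eval-≡ l r
      (trans (VertexAction.run-++ (pow σ₁ (+ (2 ℕ.* M))) (gen σ₂) v₀)
        (trans (cong (VertexAction.run (pow σ₁ (+ (2 ℕ.* M)))) σ₂-v₀)
          (trans σ₁-V (sym (trans (cong sV₂ σ₁-V) (trans (sV₂-V₀ (+ M))
            (V₀-cong (by-multiple (+ 2) (ℤ∣.∣-trans A∣B B∣uM) (lem₁ u (+ M))))))))))
      (trans (FaceAction.run-++ (pow σ₁ (+ (2 ℕ.* M))) (gen σ₂) f₀)
        (trans (cong (FaceAction.run (pow σ₁ (+ (2 ℕ.* M)))) (sF₂-face (+ 0)))
          (trans (cong (λ n → FaceAction.run (pow σ₁ n) (face (+ 0 + + 1))) (ℤₚ.pos-* 2 M))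
            (trans (σ₁-even-F (+ 0 + + 1) (+ M)) (trans (face-cong (by-multiple (- + 4) B∣uM (lem₂ u (+ M))))
              (sym (trans (cong sF₂ (σ₁-F (+ (2 ℕ.* M)))) (sF₂-face (+ 0)))))))))
      where
      σ₁-V : VertexAction.run (pow σ₁ (+ (2 ℕ.* M))) v₀ ≡ V₀ (+ M)
      σ₁-V = trans (cong (λ n → VertexAction.run (pow σ₁ n) v₀) (ℤₚ.pos-* 2 M)) (σ₁-even-V (+ M))
      lem₁ : ∀ u m → m + + 2 * (u * m) - m ≡ + 2 * (u * m)
      lem₁ = solve-∀
      lem₂ : ∀ u m → (+ 1 - + 4 * (u * m)) * (+ 0 + + 1) - (+ 0 + + 1) ≡ - + 4 * (u * m)
      lem₂ = solve-∀

    sound : ∀ {w w′} → w ≈⟨ R ⟩ w′ → AutEq polyhedron (evalP w) (evalP w′)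
    sound {w} {w′} e = eval-≡ w w′
      (VertexAction.run-sound R (λ l r lr∈R x → trans (sym (aV-eval l x))
        (trans (proj₁ (relation-holds l r lr∈R) x) (aV-eval r x))) e v₀)
      (FaceAction.run-sound R (λ l r lr∈R x → trans (sym (aF-eval l x))
        (trans (proj₂ (proj₂ (relation-holds l r lr∈R)) x) (aF-eval r x))) e f₀)

    instance
      2A-nonZero : NonZero (2 ℕ.* A)
      2A-nonZero = ℕₚ.m*n≢0 2 A

    open NormalForm (2 ℕ.* A) B M t C hiding (R; _≈_)

    private
      parity : ∀ i → Σ[ k ∈ ℕ ] (+ i ≡ + 2 * + k ⊎ + i ≡ + 1 + + 2 * + k)
      parity zero    = 0 , inj₁ refl
      parity (suc i) with parity i
      ... | k , inj₁ eq = k , inj₂ (cong (λ n → + 1 + n) eq)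
      ... | k , inj₂ eq = suc k , inj₁ (trans (cong (λ n → + 1 + n) eq) (lem (+ k)))
        where
        lem : ∀ k → + 1 + (+ 1 + + 2 * k) ≡ + 2 * (+ 1 + k)
        lem = solve-∀

      double : ∀ {k l} → k ≈ l [ A ] → + 2 * k ≈ + 2 * l [ 2 ℕ.* A ]
      double {k} {l} (mod (ℤ∣.divides x eq)) = mod (ℤ∣.divides x
        (trans (lem₁ k l) (trans (cong (λ n → + 2 * n) eq)
          (trans (lem₂ x (+ A)) (cong (x *_) (sym (ℤₚ.pos-* 2 A)))))))
        where
        lem₁ : ∀ k l → + 2 * k - + 2 * l ≡ + 2 * (k - l)
        lem₁ = solve-∀
        lem₂ : ∀ x a → + 2 * (x * a) ≡ x * (+ 2 * a)
        lem₂ = solve-∀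

    at-even : ∀ {i} k → + i ≡ + 2 * + k → VertexAction.run (pow σ₁ (+ i)) v₀ ≡ V₀ (+ k)
    at-even k p = trans (cong (λ n → VertexAction.run (pow σ₁ n) v₀) p) (σ₁-even-V (+ k))

    at-odd : ∀ {i} k → + i ≡ + 1 + + 2 * + k → VertexAction.run (pow σ₁ (+ i)) v₀ ≡ V₁ (+ k)
    at-odd k p = trans (cong (λ n → VertexAction.run (pow σ₁ n) v₀) p) (σ₁-odd-V (+ k))

    -- Even powers of σ₁ take `v₀` into the copy `V₀` and odd powers into `V₁`. Equal images
    -- therefore force equal parity, and the halved exponents agree modulo A.
    σ₁-orbit-injective : ∀ i j → VertexAction.run (pow σ₁ (+ i)) v₀ ≡ VertexAction.run (pow σ₁ (+ j)) v₀ →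
                         + i ≈ + j [ 2 ℕ.* A ]
    σ₁-orbit-injective i j eq with parity i | parity j
    ... | k , inj₁ p | l , inj₁ q = subst₂ (_≈_[ 2 ℕ.* A ]) (sym p) (sym q)
      (double {+ k} {+ l} (V₀-injective (trans (sym (at-even k p)) (trans eq (at-even l q)))))
    ... | k , inj₂ p | l , inj₂ q = subst₂ (_≈_[ 2 ℕ.* A ]) (sym p) (sym q)
      (+-≈ (≈-rfl {a = + 1}) (double {+ k} {+ l} (V₁-injective
        (trans (sym (at-odd k p)) (trans eq (at-odd l q))))))
    ... | k , inj₁ p | l , inj₂ q = ⊥-elim (V₀≢V₁ (trans (sym (at-even k p)) (trans eq (at-odd l q))))
    ... | k , inj₂ p | l , inj₁ q = ⊥-elim (V₀≢V₁ (trans (sym (at-even l q)) (trans (sym eq) (at-odd k p))))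

    normal-form-F : ∀ j i → aF (evalP (b ^ j · a ^ i · [])) f₀ ≡ face (+ j)
    normal-form-F j i = trans (aF-eval (b ^ j · a ^ i · []) f₀) (trans (FaceAction.run-++ (pow σ₂ (+ j)) _ f₀)
      (trans (cong (FaceAction.run (pow σ₂ (+ j)))
        (trans (FaceAction.run-++ (pow σ₁ (+ i)) [] f₀) (σ₁-F (+ i)))) (σ₂-F (+ j))))

    normal-form-V : ∀ j i → aV (evalP (b ^ j · a ^ i · [])) v₀
                            ≡ aV (evalP (pow σ₂ (+ j))) (VertexAction.run (pow σ₁ (+ i)) v₀)
    normal-form-V j i = trans (aV-eval (b ^ j · a ^ i · []) v₀) (trans (VertexAction.run-++ (pow σ₂ (+ j)) _ v₀)
      (trans (cong (VertexAction.run (pow σ₂ (+ j))) (VertexAction.run-++ (pow σ₁ (+ i)) [] v₀))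
        (sym (aV-eval (pow σ₂ (+ j)) _))))

    complete : ∀ w w′ → AutEq polyhedron (evalP w) (evalP w′) → w ≈⟨ R ⟩ w′
    complete w w′ eq with normalise w | normalise w′
    ... | j , i , e | j′ , i′ , e′ = e ⟫ normal-forms-≈ i≡ j≡ ⟫ ≈-sym e′
      where
      j≡ : j ℕ.% B ≡ j′ ℕ.% B
      j≡ = ≈⇒%≡ (residue-injective (trans (sym (normal-form-F j i))
        (trans (sym (proj₂ (proj₂ (sound e)) f₀)) (trans (proj₂ (proj₂ eq) f₀)
          (trans (proj₂ (proj₂ (sound e′)) f₀) (normal-form-F j′ i′))))))
      i≡ : i ℕ.% (2 ℕ.* A) ≡ i′ ℕ.% (2 ℕ.* A)
      i≡ = ≈⇒%≡ (σ₁-orbit-injective i i′ (aV-injective (evalP (pow σ₂ (+ j)))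
        (trans (sym (normal-form-V j i)) (trans (sym (proj₁ (sound e) v₀)) (trans (proj₁ eq v₀)
          -- The second normal form is rewritten with the exponent `j`, so that σ₂^j can be
          -- cancelled from both images.
          (trans (proj₁ (sound (e′ ⟫ normal-forms-≈ refl (sym j≡))) v₀) (normal-form-V j i′)))))))

    -- Transitivity and the two classes of flags

    toward : ∀ v f → Σ[ w ∈ Word ] (aV (evalP w) v₀ ≡ v × aF (evalP w) f₀ ≡ f)
    toward v f with faceView f
    -- σ₁ fixes `f₀`, so `j` is read off from the face, and `i` from the vertex once σ₂^j has been
    -- undone.
    ... | mkFace j = let (i , eq) = reach (bV spin v) in
        b ^ j · a ^ i · [] ,
        trans (normal-form-V j i) (trans (cong (aV spin) eq) (abV spin v)) ,
        normal-form-F j i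
      where
      spin = evalP (pow σ₂ (+ j))
      reach : ∀ v → Σ[ i ∈ ℕ ] VertexAction.run (pow σ₁ (+ i)) v₀ ≡ v
      reach v with vertexView v
      ... | even n = 2 ℕ.* n , at-even n (ℤₚ.pos-* 2 n)
      ... | odd n  = suc (2 ℕ.* n) ,
        at-odd n (cong (λ k → + 1 + k) (ℤₚ.pos-* 2 n))

    generated : ∀ a → Σ[ w ∈ Word ] AutEq polyhedron a (evalP w)
    generated c = let (w , eqV , eqF) = toward (aV c v₀) (aF c f₀) in
      w , faithful c (evalP w) (sym eqV) (sym eqF)

    aim : Fin (A ℕ.+ A) → Fin B → Aut polyhedron
    aim v f = evalP (proj₁ (toward v f))

    aim-V : ∀ v f → aV (aim v f) v₀ ≡ v
    aim-V v f = proj₁ (proj₂ (toward v f))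

    aim-F : ∀ v f → aF (aim v f) f₀ ≡ f
    aim-F v f = proj₂ (proj₂ (toward v f))

    -- The rotation aim v f takes one of the two edges at v₀ and f₀ to the edge of the flag;
    -- the class of the flag records which one.
    cls : Flag polyhedron → Bool
    cls Φ = ⌊ aE (aim (fv Φ) (ff Φ)) e₀ Fin.≟ fe Φ ⌋

    edgeOf : Bool → Fin (A ℕ.* B)
    edgeOf b = if b then e₀ else e₁

    aim-E : ∀ Φ → aE (aim (fv Φ) (ff Φ)) (edgeOf (cls Φ)) ≡ fe Φ
    aim-E Φ@(flag v e f ve ef) with aE (aim v f) e₀ Fin.≟ e
    ... | yes eq = eq
    ... | no ne  = exactly-two-unique (diamond v f) (at v₀∈e₁ e₁∈f₀) (ve , ef) (at v₀∈e₀ e₀∈f₀)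
        (e₀≢e₁-at (aim v f)) (ne ∘ sym)
      where
      at : ∀ {d} → T (IVE v₀ d) → T (IEF d f₀) → T (IVE v (aE (aim v f) d)) × T (IEF (aE (aim v f) d) f)
      at {d} vd df = subst (λ x → T (IVE x (aE (aim v f) d))) (aim-V v f) (imageVE (aim v f) vd) ,
                     subst (T ∘ IEF (aE (aim v f) d)) (aim-F v f) (imageEF (aim v f) df)

    -- If i is 0 or 2 and the classes agreed, then c = g′⁻¹ g would fix the edge that the class
    -- selects and one of `v₀` and `f₀`; by `Reversal` it would fix the other too, and the flags
    -- would not differ. If i = 1, both flags have the same `aim`, so their common class would
    -- determine their edge.
    adjacent-cls : ∀ i Φ Ψ → Adjacent polyhedron i Φ Ψ → cls Φ ≢ cls Ψ
    adjacent-cls i Φ Ψ adj same = contra i adj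
      where
      g = aim (fv Φ) (ff Φ)
      g′ = aim (fv Ψ) (ff Ψ)
      c = _∘A_ polyhedron (invAut polyhedron g′) g
      fixE : fe Φ ≡ fe Ψ → aE c (edgeOf (cls Φ)) ≡ edgeOf (cls Φ)
      fixE eq = trans (cong (bE g′) (trans (aim-E Φ) (trans eq (trans (sym (aim-E Ψ))
        (cong (aE g′ ∘ edgeOf) (sym same)))))) (baE g′ _)
      fixF : ff Φ ≡ ff Ψ → aF c f₀ ≡ f₀
      fixF eq = trans (cong (bF g′) (trans (aim-F _ _) (trans eq (sym (aim-F _ _))))) (baF g′ f₀)
      fixV : fv Φ ≡ fv Ψ → aV c v₀ ≡ v₀
      fixV eq = trans (cong (bV g′) (trans (aim-V _ _) (trans eq (sym (aim-V _ _))))) (baV g′ v₀)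
      vertex : ∀ b → aE c (edgeOf b) ≡ edgeOf b → aF c f₀ ≡ f₀ → aV c v₀ ≡ v₀
      vertex true  = Reversal.vertex-e₀ c
      vertex false = Reversal.vertex-e₁ c
      faces : ∀ b → aE c (edgeOf b) ≡ edgeOf b → aV c v₀ ≡ v₀ → aF c f₀ ≡ f₀
      faces true  = Reversal.face-e₀ c
      faces false = Reversal.face-e₁ c
      contra : ∀ i → Adjacent polyhedron i Φ Ψ → ⊥
      contra Fin.zero (v≢ , e≡ , f≡) = v≢ (trans (sym (aim-V _ _)) (trans (sym (abV g′ _))
        (trans (cong (aV g′) (vertex (cls Φ) (fixE e≡) (fixF f≡))) (aim-V _ _))))
      contra (Fin.suc Fin.zero) (v≡ , e≢ , f≡) = e≢ (trans (sym (aim-E Φ))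
        (trans (cong₂ aE (cong₂ aim v≡ f≡) (cong edgeOf same)) (aim-E Ψ)))
      contra (Fin.suc (Fin.suc Fin.zero)) (v≡ , e≡ , f≢) = f≢ (trans (sym (aim-F _ _)) (trans (sym (abF g′ _))
        (trans (cong (aF g′) (faces (cls Φ) (fixE e≡) (fixV v≡))) (aim-F _ _))))

    transitive-on-class : ∀ Φ Ψ → cls Φ ≡ cls Ψ →
                          Σ[ a ∈ Aut polyhedron ] FlagEq polyhedron (act polyhedron a Φ) Ψ
    transitive-on-class Φ Ψ same = _∘A_ polyhedron g′ (invAut polyhedron g) ,
      trans (cong (aV g′) (trans (cong (bV g) (sym (aim-V _ _))) (baV g v₀))) (aim-V _ _) ,
      trans (cong (aE g′) (trans (cong (bE g) (sym (aim-E Φ))) (trans (baE g _) (cong edgeOf same)))) (aim-E Ψ) ,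
      trans (cong (aF g′) (trans (cong (bF g) (sym (aim-F _ _))) (baF g f₀))) (aim-F _ _)
      where
      g = aim (fv Φ) (ff Φ)
      g′ = aim (fv Ψ) (ff Ψ)

    chiral : Chiral polyhedron
    chiral = cls , adjacent-cls , transitive-on-class , λ flag-transitive →
      let (a , eqV , eqE , eqF) = flag-transitive base base¹ in
      e₀≢e₁ (trans (sym (Mirror.no-mirror a eqV eqF)) eqE)

    2A≡A+A : A ℕ.+ A ≡ 2 ℕ.* A
    2A≡A+A = cong (A ℕ.+_) (sym (ℕₚ.+-identityʳ A))

    tight : flagCount polyhedron ≡ 2 ℕ.* (2 ℕ.* A) ℕ.* B
    tight = trans (flagCount-by-valency polyhedron B edges-at-vertex) (lem A B)
      where
      lem : ∀ x y → (x ℕ.+ x) ℕ.* (y ℕ.* 2) ≡ 2 ℕ.* (2 ℕ.* x) ℕ.* y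
      lem = solveℕ-∀

    isAutGroupOfTightChiral : IsAutGroupOfTightChiral R (2 ℕ.* A) B
    isAutGroupOfTightChiral = polyhedron ,
      ((λ f → trans (edges-at-face f) 2A≡A+A) , edges-at-vertex) , tight , chiral ,
      base , s₁ , s₂ , isSigma₁ , isSigma₂ , (λ w w′ → sound , complete w w′) , generated

-- The parameters of the theorem

open import Data.Nat using (ℕ; _+_; _*_; _∸_; _^_; _≤_; _<_)
open import Data.Nat.Divisibility using (_∣_; ∣⇒≤; ∣-trans; m∣m*n; n∣m*n; ∣m+n∣m⇒∣n; *-cancelʳ-∣; divides; m%n≡0⇒n∣m)
open import Data.Nat.Primality using (Prime; euclidsLemma; prime⇒nonZero; prime⇒nonTrivial)

odd-half : ∀ m → ¬ (2 ∣ m) → Σ[ h ∈ ℕ ] m + 1 ≡ 2 * h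
odd-half m 2∤m with m ℕ.% 2 in eq | ℕ.m%n<n m 2
... | 0           | _ = ⊥-elim (2∤m (m%n≡0⇒n∣m m 2 eq))
... | 1           | _ = suc (m ℕ./ 2) ,
    trans (cong (_+ 1) (trans (ℕ.m≡m%n+[m/n]*n m 2) (cong (_+ m ℕ./ 2 * 2) eq))) (lem (m ℕ./ 2))
  where
  lem : ∀ x → 1 + x * 2 + 1 ≡ 2 * (1 + x)
  lem = solveℕ-∀
... | suc (suc _) | ℕ.s≤s (ℕ.s≤s ())

^-monoʳ-∣ : ∀ m {i j} → i ≤ j → m ^ i ∣ m ^ j
^-monoʳ-∣ m {i} {j} i≤j = subst (m ^ i ∣_)
  (trans (sym (ℕₚ.^-distribˡ-+-* m i (j ∸ i))) (cong (m ^_) (ℕₚ.m+[n∸m]≡n i≤j))) (m∣m*n (m ^ (j ∸ i)))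

-- Here `b` is β - 2 and `h` is (m + 1)/2. Allowing α = β covers the first family.
module Instance (m α b k h : ℕ) (m-prime : Prime m) (2∤m : ¬ (2 ∣ m)) (1≤α : 1 ≤ α) (α≤β : α ≤ 2 + b)
  (1≤k : 1 ≤ k) (k≤m-1 : k ≤ m ∸ 1) (m+1≡2h : m + 1 ≡ 2 * h) where

  instance
    m-nonZero : NonZero m
    m-nonZero = prime⇒nonZero m-prime

  -- `n` is m^(β-1), and m^β unfolds to `m * n`, so `B` agrees with m^β by computation.
  n A B : ℕ
  n = m ^ (1 + b)
  A = m ^ α
  B = m * n

  instance
    n-nonZero : NonZero n
    n-nonZero = ℕₚ.m^n≢0 m (1 + b)
    A-nonZero : NonZero A
    A-nonZero = ℕₚ.m^n≢0 m α
    B-nonZero : NonZero B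
    B-nonZero = ℕₚ.m*n≢0 m n

  -- Since 2h = m + 1, h is the inverse of 2 modulo m.
  u : ℤ
  u = + (k * h * h * n)

  1<m : 1 < m
  1<m = ℕ.nonTrivial⇒n>1 m {{prime⇒nonTrivial m-prime}}

  m∤1 : ¬ (m ∣ 1)
  m∤1 m∣1 = ℕₚ.<⇒≱ 1<m (∣⇒≤ m∣1)

  m∤2 : ¬ (m ∣ 2)
  m∤2 m∣2 = 2∤m (subst (2 ∣_) (ℕₚ.≤-antisym 1<m (∣⇒≤ m∣2)) (divides 1 refl))

  m∤k : ¬ (m ∣ k)
  m∤k m∣k = ℕₚ.<⇒≱ (ℕₚ.≤-<-trans k≤m-1 (ℕₚ.∸-monoʳ-< {m} (ℕ.s≤s ℕ.z≤n) (ℕₚ.<⇒≤ 1<m)))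
    (∣⇒≤ {{ℕ.>-nonZero 1≤k}} m∣k)

  m∤h : ¬ (m ∣ h)
  m∤h m∣h = m∤1 (∣m+n∣m⇒∣n (subst (m ∣_) (sym m+1≡2h) (∣-trans m∣h (n∣m*n 2)))
    (divides 1 (sym (ℕₚ.*-identityˡ m))))

  m∣B : m ∣ B
  m∣B = m∣m*n n

  A∣B : A ∣ B
  A∣B = ^-monoʳ-∣ m α≤β

  ⌜_⌝ : ∀ {i j} → i ∣ j → + i ∣ℤ + j
  ⌜ p ⌝ = ℤ∣.∣ᵤ⇒∣ p

  B∣u² : + B ∣ℤ (u ℤ.* u)
  B∣u² = subst (+ B ∣ℤ_) (ℤₚ.pos-* (k * h * h * n) (k * h * h * n))
    ⌜ divides (k * h * h * (k * h * h) * m ^ b) (lem (k * h * h) m (m ^ b)) ⌝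
    where
    lem : ∀ x m y → x * (m * y) * (x * (m * y)) ≡ x * x * y * (m * (m * y))
    lem = solveℕ-∀

  B∣um : + B ∣ℤ (u ℤ.* + m)
  B∣um = subst (+ B ∣ℤ_) (ℤₚ.pos-* (k * h * h * n) m) ⌜ divides (k * h * h) (lem (k * h * h) n m) ⌝
    where
    lem : ∀ x n m → x * n * m ≡ x * (m * n)
    lem = solveℕ-∀

  B∣uA : + B ∣ℤ (u ℤ.* + A)
  B∣uA = ℤ∣.∣-trans B∣um (ℤ∣.*-monoʳ-∣ u ⌜ subst (_∣ A) (ℕₚ.*-identityʳ m) (^-monoʳ-∣ m 1≤α) ⌝)

  B∤2 : ¬ (+ B ∣ℤ (+ 2))
  B∤2 B∣2 = m∤2 (∣-trans m∣B (ℤ∣.∣⇒∣ᵤ B∣2))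

  -- Cancelling n leaves m ∣ 8kh², and the prime m divides none of 2, k and h.
  B∤8u : ¬ (+ B ∣ℤ (+ 8 ℤ.* u))
  B∤8u p with euclidsLemma (8 * k * h) h m-prime (*-cancelʳ-∣ n (subst (B ∣_) (lem k h n)
      (ℤ∣.∣⇒∣ᵤ (subst (+ B ∣ℤ_) (sym (ℤₚ.pos-* 8 (k * h * h * n))) p))))
    where
    lem : ∀ k h n → 8 * (k * h * h * n) ≡ 8 * k * h * h * n
    lem = solveℕ-∀
  ... | inj₂ m∣h = m∤h m∣h
  ... | inj₁ m∣8kh with euclidsLemma (8 * k) h m-prime m∣8kh
  ... | inj₂ m∣h = m∤h m∣h
  ... | inj₁ m∣8k with euclidsLemma 8 k m-prime m∣8k
  ... | inj₂ m∣k = m∤k m∣k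
  ... | inj₁ m∣8 with euclidsLemma 2 4 m-prime m∣8
  ... | inj₁ m∣2 = m∤2 m∣2
  ... | inj₂ m∣4 with euclidsLemma 2 2 m-prime m∣4
  ... | inj₁ m∣2 = m∤2 m∣2
  ... | inj₂ m∣2 = m∤2 m∣2

  C : ℕ
  C = k * n

  ℕ-≈ : ∀ {i j} q → j ≡ i + q * B → + i ≈ + j [ B ]
  ℕ-≈ {i} {j} q eq = ≈-symm (mod (ℤ∣.divides (+ q) (trans (cong (λ x → + x ℤ.- + i) eq)
    (trans (cong (ℤ._- + i) (trans (ℤₚ.pos-+ i (q * B)) (cong (λ x → + i ℤ.+ x) (ℤₚ.pos-* q B)))) (lem (+ i) _)))))
    where
    lem : ∀ i x → i ℤ.+ x ℤ.- i ≡ x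
    lem = solve-∀

  -- The origin of the factor h² in `u`: it inverts 4 modulo m, so 4u ≡ kn modulo mn.
  4h²≡ : 2 * h * (2 * h) ≡ 1 + (2 + m) * m
  4h²≡ = trans (cong₂ _*_ (sym m+1≡2h) (sym m+1≡2h)) (lem m)
    where
    lem : ∀ m → (m + 1) * (m + 1) ≡ 1 + (2 + m) * m
    lem = solveℕ-∀

  C≈4u : + C ≈ + 4 ℤ.* u [ B ]
  C≈4u = subst (λ x → + C ≈ x [ B ]) (ℤₚ.pos-* 4 (k * h * h * n))
    (ℕ-≈ (k * (2 + m)) (trans (lem₁ k h n) (trans (cong (λ x → k * x * n) 4h²≡) (lem₂ k m n))))
    where
    lem₁ : ∀ k h n → 4 * (k * h * h * n) ≡ k * (2 * h * (2 * h)) * n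
    lem₁ = solveℕ-∀
    lem₂ : ∀ k m n → k * (1 + (2 + m) * m) * n ≡ k * n + k * (2 + m) * (m * n)
    lem₂ = solveℕ-∀

  module _ (t : ℕ) (H≈2u : + (m * t) ≈ + 2 ℤ.* u [ A ]) where
    open Model.Relators A B u ⌜ A∣B ⌝ B∣u² B∣uA B∤2 B∤8u m t C B∣um H≈2u C≈4u public
      using (isAutGroupOfTightChiral)

  -- The exponent k(m + 1)n is needed in the form 2·m·t; with m + 1 = 2h and n = m·m^b this is the
  -- value of t.
  t₁ : ℕ
  t₁ = k * h * m ^ b

  H₁≈2u : + (m * t₁) ≈ + 2 ℤ.* u [ A ]
  H₁≈2u = ≈-weaken ⌜ A∣B ⌝ (subst (λ x → + (m * t₁) ≈ x [ B ]) (ℤₚ.pos-* 2 (k * h * h * n))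
    (ℕ-≈ (k * h) (trans (lem₁ k h n) (trans (cong (λ x → k * h * x * n) (sym m+1≡2h)) (lem₂ k h m (m ^ b))))))
    where
    lem₁ : ∀ k h n → 2 * (k * h * h * n) ≡ k * h * (2 * h) * n
    lem₁ = solveℕ-∀
    lem₂ : ∀ k h m y → k * h * (m + 1) * (m * y) ≡ m * (k * h * y) + k * h * (m * (m * y))
    lem₂ = solveℕ-∀

  E₁≡ : 2 * m * t₁ ≡ k * (m + 1) * n
  E₁≡ = trans (lem k h m (m ^ b)) (cong (λ x → k * x * n) (sym m+1≡2h))
    where
    lem : ∀ k h m y → 2 * m * (k * h * y) ≡ k * (2 * h) * (m * y)
    lem = solveℕ-∀

  first : IsAutGroupOfTightChiral (presentation (2 * A) B m (k * (m + 1) * n) C) (2 * A) B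
  first = subst (λ E → IsAutGroupOfTightChiral (presentation (2 * A) B m E C) (2 * A) B) E₁≡
    (isAutGroupOfTightChiral t₁ H₁≈2u)

  -- For α < β, A divides n and hence u, so t = 0 meets the condition m·t ≡ 2u modulo A.
  second : α ≤ 1 + b → IsAutGroupOfTightChiral (presentation (2 * A) B m 0 C) (2 * A) B
  second α<β = subst (λ E → IsAutGroupOfTightChiral (presentation (2 * A) B m E C) (2 * A) B) (ℕₚ.*-zeroʳ (2 * m))
    (isAutGroupOfTightChiral 0 (subst (λ x → + x ≈ + 2 ℤ.* u [ A ]) (sym (ℕₚ.*-zeroʳ m))
      (≈-symm (mod (subst (+ A ∣ℤ_) (sym (trans (ℤₚ.+-identityʳ (+ 2 ℤ.* u)) (sym (ℤₚ.pos-* 2 (k * h * h * n)))))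
        ⌜ ∣-trans (^-monoʳ-∣ m α<β) (divides (2 * (k * h * h)) (sym (ℕₚ.*-assoc 2 (k * h * h) n))) ⌝)))))

theorem3p9 : (m α β k : ℕ) → Prime m → ¬ (2 ∣ m) → 1 ≤ α → 2 ≤ β →
    1 ≤ k → k ≤ m ∸ 1 →
    IsAutGroupOfTightChiral (rels₁ m β k) (2 * m ^ β) (m ^ β)
    × (α < β →
    IsAutGroupOfTightChiral (rels₂ m α β k) (2 * m ^ α) (m ^ β))
theorem3p9 m α (suc (suc b)) k m-prime 2∤m 1≤α (ℕ.s≤s (ℕ.s≤s ℕ.z≤n)) 1≤k k≤m-1 with odd-half m 2∤m
... | h , m+1≡2h =
  -- The first family is the case α = β.
  Instance.first m (2 + b) b k h m-prime 2∤m (ℕ.s≤s ℕ.z≤n) ℕₚ.≤-refl 1≤k k≤m-1 m+1≡2h ,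
  λ { (ℕ.s≤s α≤1+b) → Instance.second m α b k h m-prime 2∤m 1≤α (ℕₚ.m≤n⇒m≤1+n α≤1+b) 1≤k k≤m-1 m+1≡2h α≤1+b }
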